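{- Let $\ell \ge 1$, $m \ge 2$ and $n = (3\ell+1)m$ (so $n \ge 6\ell+2$). Let $D$ be a minimum porous exponential dominating set of $C_{n,[\ell]}$. Then for every integer $s$ and every $0 \le i \le m-1$, the interval $[\,s+(3\ell+1)i,\ s+(3\ell+1)i+3\ell\,]$ contains exactly one vertex of $D$ (equivalently, for every such partition $\mathcal{I}$ of the vertex set into $m$ consecutive intervals of $3\ell+1$ vertices, $f^*(D,\mathcal{I}) = 1$ and $Z(D,\mathcal{I}) = 0$). Furthermore, $D$ is unique up to isomorphism, i.e. $D = \{c + (3\ell+1)t \bmod n : 0 \le t \le m-1\}$ for some vertex $c$.
   Context: $C_{n,[\ell]}$ has vertex set $\{0,\dots,n-1\}$ (mod $n$), with $v$ adjacent to $v\pm i \bmod n$ for $i\in\{1,\dots,\ell\}$. $\mathrm{dist}(u,v)$ is the shortest-path distance. $D\subseteq V$ is a porous exponential dominating set if $\sum_{d\in D}(1/2)^{\mathrm{dist}(d,v)-1}\ge 1$ for every vertex $v$; minimum means of minimum cardinality. For $i,j$, the interval $[i,j]$ is the set of consecutive integers mod $n$ going upward from $i$ to $j$. For a partition $\mathcal{I}=\bigcup_{k=0}^{m-1} I_k$ of the vertices into consecutive intervals, $f_k(D,\mathcal{I}) = |I_k\cap D|$, $f^*(D,\mathcal{I})=\max_k f_k(D,\mathcal{I})$, $z(D,\mathcal{I}) = \{k : f_k(D,\mathcal{I})=0\}$, $Z(D,\mathcal{I}) = |z(D,\mathcal{I})|$. -}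

module Defs where

open import Data.Nat using (ℕ; zero; suc; _+_; _*_; _∸_; _≤_; _<_; _≡ᵇ_; NonZero)
open import Data.Nat.DivMod using (_%_)
open import Data.Fin using (Fin; toℕ)
import Data.Fin as Fin
open import Data.Fin.Subset using (Subset; _∈_; inside; outside)
open import Data.Bool using (Bool; true; false; _∧_; _∨_; if_then_else_)
open import Data.List using (List; upTo; map; allFin)
open import Data.Bool.ListAction using (any)
open import Data.Vec using (tabulate; lookup)
open import Data.Rational using (ℚ; 0ℚ; 1ℚ; ½) renaming (_+_ to _+ℚ_; _*_ to _*ℚ_; _≤_ to _≤ℚ_)
open import Relation.Nullary.Decidable using (⌊_⌋)
open import Relation.Binary.PropositionalEquality using (subst)
open import Data.Nat.Properties using (m*n≢0; +-comm)
open import Data.Product using (_×_)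

-- The circulant graph C_{n,[ℓ]} on vertex set Fin n (= {0,…,n-1} mod n):
-- v is adjacent to v + i mod n and v - i mod n for i ∈ {1,…,ℓ}.
-- "u = v - i mod n" is expressed equivalently as "v = u + i mod n".
adj : (n ℓ : ℕ) → .{{_ : NonZero n}} → Fin n → Fin n → Bool
adj n ℓ u v = any (λ i → (toℕ v ≡ᵇ (toℕ u + i) % n) ∨ (toℕ u ≡ᵇ (toℕ v + i) % n))
                  (map suc (upTo ℓ))

ball : (n ℓ : ℕ) → .{{_ : NonZero n}} → ℕ → Fin n → Fin n → Bool
ball n ℓ zero    u v = ⌊ u Fin.≟ v ⌋
ball n ℓ (suc k) u v = ball n ℓ k u v ∨ any (λ w → ball n ℓ k u w ∧ adj n ℓ w v) (allFin n)

-- least k in [k₀, k₀ + fuel] with ball k u v (default: k₀ + fuel).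
search : (n ℓ : ℕ) → .{{_ : NonZero n}} → Fin n → Fin n → ℕ → ℕ → ℕ
search n ℓ u v k zero       = k
search n ℓ u v k (suc fuel) = if ball n ℓ k u v then k else search n ℓ u v (suc k) fuel

-- Shortest-path distance in C_{n,[ℓ]}: the least k such that v is reachable
-- from u by a walk of length ≤ k (searched over 0 ≤ k ≤ n; the graph is
-- connected for ℓ ≥ 1, so every distance is < n).
dist : (n ℓ : ℕ) → .{{_ : NonZero n}} → Fin n → Fin n → ℕ
dist n ℓ u v = search n ℓ u v 0 n

-- (1/2)^(k-1) as a rational (equal to 2 for k = 0).
halfPow : ℕ → ℚ
halfPow zero = 1ℚ +ℚ 1ℚ
halfPow (suc zero) = 1ℚ
halfPow (suc (suc k)) = ½ *ℚ halfPow (suc k)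

weight : (n ℓ : ℕ) → .{{_ : NonZero n}} → Subset n → Fin n → ℚ
weight n ℓ D v = sumFin n (λ d → if lookup D d then halfPow (dist n ℓ d v) else 0ℚ)
  where
  sumFin : (m : ℕ) → (Fin m → ℚ) → ℚ
  sumFin zero    f = 0ℚ
  sumFin (suc m) f = f Fin.zero +ℚ sumFin m (λ i → f (Fin.suc i))

IsPED : (n ℓ : ℕ) → .{{_ : NonZero n}} → Subset n → Set
IsPED n ℓ D = ∀ v → 1ℚ ≤ℚ weight n ℓ D v

open import Data.Fin.Subset using (∣_∣)

IsMinPED : (n ℓ : ℕ) → .{{_ : NonZero n}} → Subset n → Set
IsMinPED n ℓ D = IsPED n ℓ D × (∀ D′ → IsPED n ℓ D′ → ∣ D ∣ ≤ ∣ D′ ∣)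

interval : (n : ℕ) → .{{_ : NonZero n}} → ℕ → ℕ → Subset n
interval n a len = tabulate (λ v → any (λ j → toℕ v ≡ᵇ (a + j) % n) (upTo (suc len)))

progression : (n : ℕ) → .{{_ : NonZero n}} → Fin n → ℕ → ℕ → Subset n
progression n c step m = tabulate (λ v → any (λ t → toℕ v ≡ᵇ (toℕ c + step * t) % n) (upTo m))

nz : (ℓ m : ℕ) → 1 ≤ m → NonZero ((3 * ℓ + 1) * m)
nz ℓ (suc m) _ = m*n≢0 (3 * ℓ + 1) (suc m) {{nz3}}
  where
  nz3 : NonZero (3 * ℓ + 1)
  nz3 = subst NonZero (+-comm 1 (3 * ℓ)) _

{-# OPTIONS --safe #-}
-- Let a(v) and b(v) be the integer parts of three times the total weight sent to v from its
-- left and from its right. Passing from v to v + ℓ halves the former and doubles the latter, up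
-- to the dominators met on the way, and domination of v ∉ D forces a(v) + b(v) ≥ 2. The potential
--   pot a(v) − pot b(v),   pot 0 = 0, pot 1 = 1, pot x = 2 ⌊log₂ x⌋ for x ≥ 2,
-- drops by at least 2 in each step, less 6 for each dominator strictly between v and v + ℓ and
-- 4 for each one at an end. Summed over all v the potential cancels, which leaves
-- 2n ≤ (6 (ℓ − 1) + 8) |D|, that is |D| ≥ m. The progression of step 3ℓ + 1 dominates, so a
-- minimum D makes every step tight; tightness at v ∈ D forces b(v + ℓ) = 0 and no dominator in
-- (v, v + ℓ], so that the next dominator is beyond v + 3ℓ. Hence each interval of 3ℓ + 1
-- vertices holds at most one dominator, and by counting exactly one.
module Submission where

open import Defs
open import Data.Nat using (ℕ; zero; suc; _+_; _*_; _∸_; _^_; _/_; _%_; _≤_; _<_; s≤s; z≤n; _≡ᵇ_; _≤?_; _<?_; ⌊_/2⌋; NonZero; >-nonZero)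
open import Data.Nat.Properties hiding (_≤?_; _<?_)
open import Data.Nat.DivMod hiding (_/_; _%_)
open import Data.Nat.Divisibility using (_∣_; divides; ∣-refl; ∣m+n∣m⇒∣n; ∣⇒≤)
open import Data.Nat.Logarithm using (⌊log₂_⌋; ⌊log₂⌋-mono-≤; ⌊log₂[2*b]⌋≡1+⌊log₂b⌋)
open import Data.Nat.Tactic.RingSolver using (solve-∀)
open import Data.Fin using (Fin; toℕ)
open import Data.Fin.Properties using (toℕ-fromℕ<; toℕ-injective; toℕ<n)
open import Data.Fin.Subset using (Subset; ∣_∣; _∩_)
open import Data.Bool using (Bool; true; false; T; _∧_; if_then_else_)
open import Data.Bool.Properties using (T-∨; T-∧; ∨-comm)
open import Data.Bool.ListAction using (any)
open import Data.List using (upTo; map; allFin)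
open import Data.List.Membership.Propositional using (_∈_; find; lose)
open import Data.List.Membership.Propositional.Properties using (∈-map⁺; ∈-map⁻; ∈-upTo⁺; ∈-upTo⁻; ∈-allFin)
open import Data.List.Relation.Unary.Any.Properties using (any⁺; any⁻)
open import Data.Vec using ([]; _∷_; lookup; tabulate)
open import Data.Vec.Properties using (lookup∘tabulate; tabulate∘lookup; tabulate-cong; lookup-zipWith)
open import Data.Rational using (ℚ; 0ℚ; 1ℚ; ½) renaming (_+_ to _+ℚ_; _≤_ to _≤ℚ_; _<_ to _<ℚ_)
import Data.Rational.Properties as ℚ
open import Algebra.Properties.Monoid.Mult ℚ.+-0-monoid using () renaming (_×_ to _·_; ×-homo-+ to ·-homo-+)
open import Data.Product using (_×_; _,_; ∃; ∃₂; proj₁; proj₂)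
open import Data.Sum using (_⊎_; inj₁; inj₂; [_,_]′)
open import Data.Empty using (⊥; ⊥-elim)
open import Data.Unit using (tt)
open import Function using (_∘_)
open import Function.Bundles using (Equivalence)
open import Relation.Nullary using (¬_; yes; no; contradiction)
open import Relation.Nullary.Decidable using (toWitness; fromWitness)
open import Relation.Binary.PropositionalEquality

-- Finite sums and sums over one period.

∑ : ℕ → (ℕ → ℕ) → ℕ
∑ zero    f = 0
∑ (suc m) f = f 0 + ∑ m (f ∘ suc)

∑-mono : ∀ m {f g} → (∀ i → i < m → f i ≤ g i) → ∑ m f ≤ ∑ m g
∑-mono zero    h = z≤n
∑-mono (suc m) h = +-mono-≤ (h 0 (s≤s z≤n)) (∑-mono m (λ i i<m → h (suc i) (s≤s i<m)))

∑-cong : ∀ m {f g} → (∀ i → i < m → f i ≡ g i) → ∑ m f ≡ ∑ m g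
∑-cong zero    h = refl
∑-cong (suc m) h = cong₂ _+_ (h 0 (s≤s z≤n)) (∑-cong m (λ i i<m → h (suc i) (s≤s i<m)))

∑-+ : ∀ m f g → ∑ m (λ i → f i + g i) ≡ ∑ m f + ∑ m g
∑-+ zero    f g = refl
∑-+ (suc m) f g rewrite ∑-+ m (f ∘ suc) (g ∘ suc) = interchange (f 0) (g 0) _ _
  where
  interchange : ∀ a b c d → a + b + (c + d) ≡ a + c + (b + d)
  interchange = solve-∀

∑-* : ∀ m c f → ∑ m (λ i → c * f i) ≡ c * ∑ m f
∑-* zero    c f = sym (*-zeroʳ c)
∑-* (suc m) c f rewrite ∑-* m c (f ∘ suc) = sym (*-distribˡ-+ c (f 0) _)

∑-const : ∀ m c → ∑ m (λ _ → c) ≡ m * c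
∑-const zero    c = refl
∑-const (suc m) c = cong (c +_) (∑-const m c)

∑-split : ∀ m k f → ∑ (m + k) f ≡ ∑ m f + ∑ k (λ i → f (m + i))
∑-split zero    k f = refl
∑-split (suc m) k f rewrite ∑-split m k (f ∘ suc) = sym (+-assoc (f 0) _ _)

∑-snoc : ∀ m f → ∑ (suc m) f ≡ ∑ m f + f m
∑-snoc m f = trans (cong (λ k → ∑ k f) (+-comm 1 m)) (trans (∑-split m 1 f)
  (cong (∑ m f +_) (trans (+-identityʳ _) (cong f (+-identityʳ m)))))

∑-reverse : ∀ m f → ∑ m f ≡ ∑ m (λ i → f (m ∸ suc i))
∑-reverse zero    f = refl
∑-reverse (suc m) f = trans (∑-snoc m f) (trans (+-comm _ (f m)) (cong (f m +_) (∑-reverse m f)))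

∑-swap : ∀ m k (f : ℕ → ℕ → ℕ) → ∑ m (λ i → ∑ k (f i)) ≡ ∑ k (λ j → ∑ m (λ i → f i j))
∑-swap zero    k f = sym (trans (∑-const k 0) (*-zeroʳ k))
∑-swap (suc m) k f rewrite ∑-swap m k (f ∘ suc) = sym (∑-+ k (f 0) _)

∑-blocks : ∀ m k f → ∑ (m * k) f ≡ ∑ m (λ i → ∑ k (λ j → f (i * k + j)))
∑-blocks zero    k f = refl
∑-blocks (suc m) k f = trans (∑-split k (m * k) f) (cong (∑ k f +_)
  (trans (∑-blocks m k _) (∑-cong m (λ i _ → ∑-cong k (λ j _ → cong f (sym (+-assoc k (i * k) j)))))))

term≤∑ : ∀ m f {i} → i < m → f i ≤ ∑ m f
term≤∑ (suc m) f {zero}  _         = m≤m+n (f 0) _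
term≤∑ (suc m) f {suc i} (s≤s i<m) = ≤-trans (term≤∑ m (f ∘ suc) i<m) (m≤n+m _ (f 0))

two-terms≤∑ : ∀ m f {i} → suc i < m → f 0 + f (suc i) ≤ ∑ m f
two-terms≤∑ (suc m) f (s≤s i<m) = +-monoʳ-≤ (f 0) (term≤∑ m (f ∘ suc) i<m)

∑≡0⇒term≡0 : ∀ m f {i} → ∑ m f ≡ 0 → i < m → f i ≡ 0
∑≡0⇒term≡0 m f eq i<m = n≤0⇒n≡0 (subst (_ ≤_) eq (term≤∑ m f i<m))

∑-zero : ∀ m {f} → (∀ i → i < m → f i ≡ 0) → ∑ m f ≡ 0
∑-zero m h = trans (∑-cong m h) (trans (∑-const m 0) (*-zeroʳ m))

∑-monoˡ : ∀ {m k} f → m ≤ k → ∑ m f ≤ ∑ k f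
∑-monoˡ {m} {k} f m≤k = subst (λ j → ∑ m f ≤ ∑ j f) (m+[n∸m]≡n m≤k)
  (subst (∑ m f ≤_) (sym (∑-split m (k ∸ m) f)) (m≤m+n _ _))

∑-strict : ∀ m {f g} → (∀ i → f i ≤ g i) → ∀ j → j < m → f j < g j → ∑ m f < ∑ m g
∑-strict (suc m) h zero    _         lt = +-mono-<-≤ lt (∑-mono m (λ i _ → h (suc i)))
∑-strict (suc m) h (suc j) (s≤s j<m) lt = +-mono-≤-< (h 0) (∑-strict m (h ∘ suc) j j<m lt)

∑-saturated : ∀ m {f} → (∀ i → f i ≤ 1) → m ≤ ∑ m f → ∀ i → i < m → f i ≡ 1
∑-saturated m {f} h m≤ i i<m with f i <? 1
... | no  ≮1 = ≤-antisym (h i) (≮⇒≥ ≮1)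
... | yes <1 = ⊥-elim (<⇒≱ (∑-strict m h i i<m <1)
  (subst (_≤ ∑ m f) (sym (trans (∑-const m 1) (*-identityʳ m))) m≤))

Periodic : ∀ {a} {A : Set a} → ℕ → (ℕ → A) → Set a
Periodic n f = ∀ x → f (x + n) ≡ f x

periodic-* : ∀ {a} {A : Set a} {n} {f : ℕ → A} → Periodic n f → ∀ k x → f (x + k * n) ≡ f x
periodic-* {f = f} per zero    x = cong f (+-identityʳ x)
periodic-* {n = n} {f} per (suc k) x =
  trans (cong f (sym (+-assoc x n (k * n)))) (trans (periodic-* per k (x + n)) (per x))

-- Moving the start from `v` to `v + 1` drops `f v` and appends `f (v + n)`, which is the same
-- value.
∑-rotate : ∀ n {f} → Periodic n f → ∀ v → ∑ n (λ i → f (v + i)) ≡ ∑ n f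
∑-rotate n per zero = refl
∑-rotate n {f} per (suc v) = trans (+-cancelʳ-≡ (f v) _ _ shift) (∑-rotate n per v)
  where
  shift : ∑ n (λ i → f (suc v + i)) + f v ≡ ∑ n (λ i → f (v + i)) + f v
  shift = trans (+-comm _ (f v))
    (trans (cong₂ _+_ (cong f (sym (+-identityʳ v))) (∑-cong n (λ i _ → cong f (sym (+-suc v i)))))
    (trans (∑-snoc n (λ i → f (v + i))) (cong (∑ n (λ i → f (v + i)) +_) (per v))))

∑-at-most-one : ∀ k {f} → (∀ i → f i ≤ 1) → (∀ i j → i < j → j < k → 1 ≤ f i → f j ≡ 0) → ∑ k f ≤ 1
∑-at-most-one zero    f≤1 sep = z≤n
∑-at-most-one (suc k) {f} f≤1 sep with f 0 in eq
... | zero   = ∑-at-most-one k (f≤1 ∘ suc) (λ i j i<j j<k → sep (suc i) (suc j) (s≤s i<j) (s≤s j<k))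
... | suc f₀ = subst₂ (λ x s → x + s ≤ 1) eq (sym rest≡0) (≤-trans (≤-reflexive (+-identityʳ (f 0))) (f≤1 0))
  where
  rest≡0 : ∑ k (f ∘ suc) ≡ 0
  rest≡0 = ∑-zero k (λ i i<k → sep 0 (suc i) (s≤s z≤n) (s≤s i<k) (subst (1 ≤_) (sym eq) (s≤s z≤n)))

∑-positive : ∀ k {f} → 1 ≤ ∑ k f → ∃ λ i → i < k × 1 ≤ f i
∑-positive (suc k) {f} h with f 0 in eq
... | suc _ = 0 , s≤s z≤n , subst (1 ≤_) (sym eq) (s≤s z≤n)
... | zero with ∑-positive k h
...   | i , i<k , fi = suc i , s≤s i<k , fi

-- The potential

pot : ℕ → ℕ
pot 0 = 0
pot 1 = 1
pot n = 2 * ⌊log₂ n ⌋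

pot-mono : ∀ {m n} → m ≤ n → pot m ≤ pot n
pot-mono {0} _ = z≤n
pot-mono {1} {1} _ = ≤-refl
pot-mono {1} {suc (suc n)} _ =
  ≤-trans (s≤s z≤n) (*-monoʳ-≤ 2 (⌊log₂⌋-mono-≤ {2} {suc (suc n)} (s≤s (s≤s z≤n))))
pot-mono {suc (suc m)} {suc (suc n)} m≤n = *-monoʳ-≤ 2 (⌊log₂⌋-mono-≤ m≤n)
pot-mono {suc (suc m)} {1} (s≤s ())

pot-double : ∀ n → pot (2 * suc (suc n)) ≡ pot (suc (suc n)) + 2
pot-double n = trans (cong (2 *_) (⌊log₂[2*b]⌋≡1+⌊log₂b⌋ (suc (suc n)))) (2*-suc ⌊log₂ suc (suc n) ⌋)
  where
  2*-suc : ∀ x → 2 * (1 + x) ≡ 2 * x + 2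
  2*-suc = solve-∀

2*⌊n/2⌋≤n : ∀ n → 2 * ⌊ n /2⌋ ≤ n
2*⌊n/2⌋≤n n = ≤-trans (+-monoʳ-≤ ⌊ n /2⌋ (≤-trans (≤-reflexive (+-identityʳ _)) (⌊n/2⌋≤⌈n/2⌉ n)))
  (≤-reflexive (⌊n/2⌋+⌈n/2⌉≡n n))

n<2*suc⌊n/2⌋ : ∀ n → n < 2 * suc ⌊ n /2⌋
n<2*suc⌊n/2⌋ 0 = s≤s z≤n
n<2*suc⌊n/2⌋ 1 = s≤s (s≤s z≤n)
n<2*suc⌊n/2⌋ (suc (suc n)) = ≤-trans (s≤s (s≤s (n<2*suc⌊n/2⌋ n))) (≤-reflexive (lemma ⌊ n /2⌋))
  where
  lemma : ∀ x → 2 + 2 * suc x ≡ 2 * suc (suc x)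
  lemma = solve-∀

-- From 4 on, both `a` and its half lie in the logarithmic range of `pot`, where halving costs a
-- full unit of the logarithm.
pot-half₂ : ∀ {a} → 4 ≤ a → pot ⌊ a /2⌋ + 2 ≤ pot a
pot-half₂ {a} 4≤a with ⌊ a /2⌋ | ⌊n/2⌋-mono 4≤a | 2*⌊n/2⌋≤n a
... | suc (suc h) | _ | le = ≤-trans (≤-reflexive (sym (pot-double h))) (pot-mono le)
... | 1 | s≤s () | _

-- The values `pot 1 = 1` and `pot 2 = pot 3 = 2` split the descent from 2 to 0 into two halvings
-- that lose 1 each, so any positive value loses at least 1.
pot-half₁ : ∀ {a} → 1 ≤ a → pot ⌊ a /2⌋ + 1 ≤ pot a
pot-half₁ {1} _ = s≤s z≤n
pot-half₁ {2} _ = ≤-refl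
pot-half₁ {3} _ = ≤-refl
pot-half₁ {suc (suc (suc (suc a)))} _ =
  ≤-trans (+-monoʳ-≤ (pot ⌊ suc (suc (suc (suc a))) /2⌋) (s≤s z≤n)) (pot-half₂ {suc (suc (suc (suc a)))} (s≤s (s≤s (s≤s (s≤s z≤n)))))

-- For `z ≥ 3` adding 3 is at most a doubling.
pot-+3 : ∀ {z} → 3 ≤ z → pot (z + 3) ≤ pot z + 2
pot-+3 {suc (suc z)} 3≤z =
  ≤-trans (pot-mono (≤-trans (+-monoʳ-≤ (suc (suc z)) 3≤z) (≤-reflexive (cong (suc (suc z) +_) (sym (+-identityʳ _))))))
          (≤-reflexive (pot-double z))
pot-+3 {1} (s≤s ())

-- The effect of meeting `suc k` dominators. By `pot-+3` each one after the first raises the left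
-- side by at most 2 and the right side by 3. The first one is tight at `a = 0`, where
-- `pot 3 + 1 = 3`.
pot-jump : ∀ a k → pot (⌊ a /2⌋ + 3 * suc k) + 1 ≤ pot a + 3 * suc k
pot-jump a (suc k) = begin
  pot (⌊ a /2⌋ + 3 * suc (suc k)) + 1 ≡⟨ cong (λ x → pot x + 1) (regroup ⌊ a /2⌋ k) ⟩
  pot (⌊ a /2⌋ + 3 * suc k + 3) + 1   ≤⟨ +-monoˡ-≤ 1 (pot-+3 (≤-trans (m≤m*n 3 (suc k)) (m≤n+m _ ⌊ a /2⌋))) ⟩
  pot (⌊ a /2⌋ + 3 * suc k) + 2 + 1   ≡⟨ swap₂₁ (pot (⌊ a /2⌋ + 3 * suc k)) ⟩
  pot (⌊ a /2⌋ + 3 * suc k) + 1 + 2   ≤⟨ +-mono-≤ (pot-jump a k) (n≤1+n 2) ⟩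
  pot a + 3 * suc k + 3               ≡⟨ sym (regroup (pot a) k) ⟩
  pot a + 3 * suc (suc k)             ∎
  where
  open ≤-Reasoning
  regroup : ∀ x k → x + 3 * suc (suc k) ≡ x + 3 * suc k + 3
  regroup = solve-∀
  swap₂₁ : ∀ x → x + 2 + 1 ≡ x + 1 + 2
  swap₂₁ = solve-∀
pot-jump 0 0 = ≤-refl
pot-jump 1 0 = n≤1+n 3
-- For an argument of at least 2, half of it plus 3 is at most its double, with equality at 2;
-- doubling adds exactly 2 to `pot`.
pot-jump (suc (suc a)) 0 = ≤-trans (+-monoˡ-≤ 1 (pot-mono le)) (≤-reflexive (trans (cong (_+ 1) (pot-double a)) (+-assoc (pot (suc (suc a))) 2 1)))
  where
  le : ⌊ suc (suc a) /2⌋ + 3 ≤ 2 * suc (suc a)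
  le = ≤-trans (s≤s (+-monoˡ-≤ 3 (⌊n/2⌋≤n a))) (≤-trans (m≤m+n _ a) (≤-reflexive (double a)))
    where
    double : ∀ a → suc (a + 3) + a ≡ 2 * suc (suc a)
    double = solve-∀

pot-gain : ∀ {a a′ k} → 1 ≤ k → a′ ≤ ⌊ a /2⌋ + 3 * k → pot a′ + 1 ≤ pot a + 3 * k
pot-gain {a} {k = suc k} _ le = ≤-trans (+-monoˡ-≤ 1 (pot-mono le)) (pot-jump a k)

pot-decay : ∀ {a a′} t → (pot ⌊ a /2⌋ + t ≤ pot a) → a′ ≤ ⌊ a /2⌋ + 3 * 0 → pot a′ + t ≤ pot a
pot-decay t h le = ≤-trans (+-monoˡ-≤ t (pot-mono (≤-trans le (≤-reflexive (+-identityʳ _))))) h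

pot-decay₀ : ∀ {a a′} → a′ ≤ ⌊ a /2⌋ + 3 * 0 → pot a′ + 0 ≤ pot a
pot-decay₀ {a} = pot-decay {a} 0 (≤-trans (≤-reflexive (+-identityʳ _)) (pot-mono (⌊n/2⌋≤n a)))

pot-decay₁ : ∀ {a a′} → 1 ≤ a → a′ ≤ ⌊ a /2⌋ + 3 * 0 → pot a′ + 1 ≤ pot a
pot-decay₁ {a} 1≤a = pot-decay {a} 1 (pot-half₁ 1≤a)

pot-decay₂ : ∀ {a a′} → 2 ≤ a′ → a′ ≤ ⌊ a /2⌋ + 3 * 0 → pot a′ + 2 ≤ pot a
pot-decay₂ {a} 2≤a′ le = pot-decay {a} 2 (pot-half₂ 4≤a) le
  where
  4≤a : 4 ≤ a
  4≤a = ≤-trans (*-monoʳ-≤ 2 (≤-trans 2≤a′ (≤-trans le (≤-reflexive (+-identityʳ _))))) (2*⌊n/2⌋≤n a)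

-- An interior dominator enters the counts of both directions, 3 for each. A dominator at an end
-- enters only one; its fourth unit makes up for the domination condition lost at that end.
step-cost : ℕ → ℕ → ℕ → ℕ
step-cost y e e′ = 6 * y + 4 * (e + e′)

two-sided : ∀ {P Q R S} y e e′ → P + 1 ≤ R + 3 * (e + y) → Q + 1 ≤ S + 3 * (e′ + y) →
            P + Q + 2 + (e + e′) ≤ R + S + step-cost y e e′
two-sided {P} {Q} {R} {S} y e e′ p q = begin
  P + Q + 2 + (e + e′)                                ≡⟨ left P Q e e′ ⟩
  (P + 1) + (Q + 1) + (e + e′)                        ≤⟨ +-monoˡ-≤ (e + e′) (+-mono-≤ p q) ⟩
  (R + 3 * (e + y)) + (S + 3 * (e′ + y)) + (e + e′)   ≡⟨ right R S y e e′ ⟩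
  R + S + step-cost y e e′                            ∎
  where
  open ≤-Reasoning
  left : ∀ P Q e e′ → P + Q + 2 + (e + e′) ≡ (P + 1) + (Q + 1) + (e + e′)
  left = solve-∀
  right : ∀ R S y e e′ → (R + 3 * (e + y)) + (S + 3 * (e′ + y)) + (e + e′) ≡ R + S + (6 * y + 4 * (e + e′))
  right = solve-∀

-- Dominators at one end only: `t` is the drop on the side that meets none. It is 0 for the plain
-- inequality, and 1 makes the step strict.
one-sided : ∀ {P Q R S} e t → P + 1 ≤ R + 3 * suc e → Q + t ≤ S → P + Q + 2 + t ≤ R + S + 4 * suc e
one-sided {P} {Q} {R} {S} e t p q = begin
  P + Q + 2 + t                ≡⟨ left P Q t ⟩
  (P + 1) + (Q + t) + 1        ≤⟨ +-mono-≤ (+-mono-≤ p q) (s≤s (z≤n {e})) ⟩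
  R + 3 * suc e + S + suc e    ≡⟨ right R S e ⟩
  R + S + 4 * suc e            ∎
  where
  open ≤-Reasoning
  left : ∀ P Q t → P + Q + 2 + t ≡ (P + 1) + (Q + t) + 1
  left = solve-∀
  right : ∀ R S e → R + 3 * suc e + S + suc e ≡ R + S + 4 * suc e
  right = solve-∀

-- Unprimed values belong to `v` and primed ones to `v + ℓ`; `a` decays forward and `b′` backward.
-- The count `y` is of interior dominators, `e` and `e′` are those at the ends. Any dominator pays
-- for the step through its cost; without one, both ends are undominated by themselves and their
-- domination conditions must force the drop.
step-≤ : ∀ {a a′ b b′} y e e′ → a′ ≤ ⌊ a /2⌋ + 3 * (e + y) → b ≤ ⌊ b′ /2⌋ + 3 * (e′ + y) →
         (e ≡ 0 → 2 ≤ a + b) → (e′ ≡ 0 → 2 ≤ a′ + b′) →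
         pot a′ + pot b + 2 ≤ pot a + pot b′ + step-cost y e e′
step-≤ {a} {a′} {b} {b′} 0 0 0 a′≤ b≤ h h′ = ≤-trans (drain a b′ refl refl) (≤-reflexive (sym (+-identityʳ _)))
  where
  -- If `a = 0`, domination at `v` gives `b ≥ 2`, so `b′ ≥ 4` loses 2. If `b′ = 0`, the same holds
  -- for `a`. Otherwise both are positive and each loses 1.
  drain : ∀ x z → x ≡ a → z ≡ b′ → pot a′ + pot b + 2 ≤ pot a + pot b′
  drain zero z refl _ = ≤-trans (≤-reflexive (+-assoc (pot a′) (pot b) 2))
    (+-mono-≤ (≤-trans (≤-reflexive (sym (+-identityʳ _))) (pot-decay₀ {a} a′≤)) (pot-decay₂ {b′} (h refl) b≤))
  drain (suc x) zero _ refl = ≤-trans (≤-reflexive (swap (pot a′) (pot b)))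
    (+-mono-≤ (pot-decay₂ {a} (≤-trans (h′ refl) (≤-reflexive (+-identityʳ _))) a′≤)
              (≤-trans (≤-reflexive (sym (+-identityʳ _))) (pot-decay₀ {b′} b≤)))
    where
    swap : ∀ P Q → P + Q + 2 ≡ P + 2 + Q
    swap = solve-∀
  drain (suc x) (suc z) refl refl = ≤-trans (≤-reflexive (split (pot a′) (pot b)))
    (+-mono-≤ (pot-decay₁ {a} (s≤s z≤n) a′≤) (pot-decay₁ {b′} (s≤s z≤n) b≤))
    where
    split : ∀ P Q → P + Q + 2 ≡ (P + 1) + (Q + 1)
    split = solve-∀
step-≤ {a} {a′} {b} {b′} 0 (suc e) 0 a′≤ b≤ _ _ =
  ≤-trans (m≤m+n _ 0) (subst (λ k → pot a′ + pot b + 2 + 0 ≤ pot a + pot b′ + 4 * k) (sym (+-identityʳ (suc e)))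
    (one-sided {pot a′} {pot b} e 0
      (pot-gain {a} (s≤s z≤n) (subst (λ k → a′ ≤ ⌊ a /2⌋ + 3 * k) (+-identityʳ (suc e)) a′≤)) (pot-decay₀ {b′} b≤)))
step-≤ {a} {a′} {b} {b′} 0 0 (suc e′) a′≤ b≤ _ _ =
  ≤-trans (≤-reflexive (cong (_+ 2) (+-comm (pot a′) (pot b)))) (≤-trans (m≤m+n _ 0)
    (≤-trans (one-sided {pot b} {pot a′} e′ 0
      (pot-gain {b′} (s≤s z≤n) (subst (λ k → b ≤ ⌊ b′ /2⌋ + 3 * k) (+-identityʳ (suc e′)) b≤)) (pot-decay₀ {a} a′≤))
      (≤-reflexive (cong (_+ 4 * suc e′) (+-comm (pot b′) (pot a))))))
step-≤ {a} {a′} {b} {b′} 0 (suc e) (suc e′) a′≤ b≤ _ _ =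
  ≤-trans (m≤m+n _ _) (two-sided {pot a′} {pot b} {pot a} {pot b′} 0 (suc e) (suc e′) (pot-gain {a} (s≤s z≤n) a′≤) (pot-gain {b′} (s≤s z≤n) b≤))
step-≤ {a} {a′} {b} {b′} (suc y) e e′ a′≤ b≤ _ _ =
  ≤-trans (m≤m+n _ _) (two-sided {pot a′} {pot b} {pot a} {pot b′} (suc y) e e′
    (pot-gain {a} (≤-trans (s≤s z≤n) (m≤n+m (suc y) e)) a′≤) (pot-gain {b′} (≤-trans (s≤s z≤n) (m≤n+m (suc y) e′)) b≤))

-- With a dominator at the left end, a further one in the step leaves the surplus `e + e′` of
-- `two-sided`; if there is none, `b′` is positive and its decay by 1 is the surplus.
step-< : ∀ {a a′ b b′} y e e′ → a′ ≤ ⌊ a /2⌋ + 3 * (e + y) → b ≤ ⌊ b′ /2⌋ + 3 * (e′ + y) →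
         1 ≤ e → 1 ≤ (e′ + y) + b′ → pot a′ + pot b + 2 < pot a + pot b′ + step-cost y e e′
step-< {a} {a′} {b} {b′} y (suc e) e′ a′≤ b≤ _ h with e′ + y in eq
... | suc k = ≤-trans (≤-reflexive (+-comm 1 _)) (≤-trans (+-monoʳ-≤ _ (s≤s z≤n))
  (two-sided {pot a′} {pot b} {pot a} {pot b′} y (suc e) e′ (pot-gain {a} (s≤s z≤n) a′≤)
    (subst (λ k → pot b + 1 ≤ pot b′ + 3 * k) (sym eq) (pot-gain {b′} (s≤s z≤n) b≤))))
... | zero with m+n≡0⇒m≡0 e′ eq | m+n≡0⇒n≡0 e′ eq
...   | refl | refl = ≤-trans (≤-reflexive (+-comm 1 _))
  (subst (λ k → pot a′ + pot b + 2 + 1 ≤ pot a + pot b′ + 4 * k) (sym (+-identityʳ (suc e)))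
    (one-sided {pot a′} {pot b} e 1
      (pot-gain {a} (s≤s z≤n) (subst (λ k → a′ ≤ ⌊ a /2⌋ + 3 * k) (+-identityʳ (suc e)) a′≤)) (pot-decay₁ {b′} h b≤)))

-- Discharging a periodic weight around the cycle.

module Discharging (n′ ℓ′ : ℕ) (χ : ℕ → ℕ) (χ-periodic : Periodic (suc n′) χ) where

  n ℓ : ℕ
  n = suc n′
  ℓ = suc ℓ′

  -- σ = 1 looks forward; σ = n′ ≡ −1 (mod n) looks backward.
  module Side (σ : ℕ) where

    count : ℕ → ℕ
    count v = ∑ ℓ (λ r → χ (v + σ * suc r))

    reach : ℕ → ℕ → ℕ
    reach zero    v = 0
    reach (suc K) v = ⌊ reach K (v + σ * ℓ) /2⌋ + 3 * count v

    scaled : ℕ → ℕ → ℕ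
    scaled zero    v = 0
    scaled (suc K) v = scaled K (v + σ * ℓ) + 2 ^ K * count v

    -- Unfolding `reach` lowers the number of blocks by one. Monotonicity restores it, so that the
    -- recursion holds as an inequality with the same `K` on both sides.
    reach-suc : ∀ K v → reach K v ≤ reach (suc K) v
    reach-suc zero    v = z≤n
    reach-suc (suc K) v = +-monoˡ-≤ (3 * count v) (⌊n/2⌋-mono (reach-suc K (v + σ * ℓ)))

    private
      +-swap : ∀ x y → x + n + y ≡ x + y + n
      +-swap x y = trans (+-assoc x n y) (trans (cong (x +_) (+-comm n y)) (sym (+-assoc x y n)))

    count-periodic : Periodic n count
    count-periodic v = ∑-cong ℓ (λ r _ → trans (cong χ (+-swap v (σ * suc r))) (χ-periodic _))

    reach-periodic : ∀ K → Periodic n (reach K)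
    reach-periodic zero    v = refl
    reach-periodic (suc K) v = cong₂ (λ x y → ⌊ x /2⌋ + 3 * y)
      (trans (cong (reach K) (+-swap v (σ * ℓ))) (reach-periodic K _)) (count-periodic v)

    -- reach K v = ⌊3 · (one-sided weight at v)⌋, the weight being scaled K v / 2 ^ (K − 1).
    scaled<reach : ∀ K v → 6 * scaled K v < 2 ^ K * suc (reach K v)
    scaled<reach zero    v = s≤s z≤n
    scaled<reach (suc K) v = begin-strict
      6 * (scaled K w + 2 ^ K * c)                ≡⟨ left (scaled K w) (2 ^ K) c ⟩
      6 * scaled K w + 2 ^ K * (6 * c)            <⟨ +-monoˡ-< (2 ^ K * (6 * c)) (scaled<reach K w) ⟩
      2 ^ K * suc (reach K w) + 2 ^ K * (6 * c)   ≤⟨ +-monoˡ-≤ (2 ^ K * (6 * c)) (*-monoʳ-≤ (2 ^ K) (n<2*suc⌊n/2⌋ (reach K w))) ⟩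
      2 ^ K * (2 * suc h) + 2 ^ K * (6 * c)       ≡⟨ right (2 ^ K) h c ⟩
      2 * 2 ^ K * suc (h + 3 * c)                 ∎
      where
      open ≤-Reasoning
      w c h : ℕ
      w = v + σ * ℓ
      c = count v
      h = ⌊ reach K w /2⌋
      left : ∀ s p c → 6 * (s + p * c) ≡ 6 * s + p * (6 * c)
      left = solve-∀
      right : ∀ p h c → p * (2 * suc h) + p * (6 * c) ≡ 2 * p * suc (h + 3 * c)
      right = solve-∀

    -- Unrolled recursion: offset `suc i` lies in block `i / ℓ`, counted from 0, and each block
    -- halves the contribution.
    scaled-∑ : ∀ K v → scaled K v ≡ ∑ (K * ℓ) (λ i → χ (v + σ * suc i) * 2 ^ (K ∸ suc (i / ℓ)))
    scaled-∑ zero    v = refl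
    scaled-∑ (suc K) v = sym (trans
      (∑-split ℓ (K * ℓ) (λ i → χ (v + σ * suc i) * 2 ^ (K ∸ i / ℓ))) (trans (cong₂ _+_ near far) (+-comm (2 ^ K * count v) _)))
      where
      far : ∑ (K * ℓ) (λ i → χ (v + σ * suc (ℓ + i)) * 2 ^ (K ∸ (ℓ + i) / ℓ)) ≡ scaled K (v + σ * ℓ)
      far = trans (∑-cong (K * ℓ) (λ i _ → cong₂ (λ x q → χ x * 2 ^ (K ∸ q)) (offset v σ ℓ i)
              (trans (+-distrib-/-∣ˡ i ∣-refl) (cong (_+ i / ℓ) (n/n≡1 ℓ)))))
              (sym (scaled-∑ K (v + σ * ℓ)))
        where
        offset : ∀ v σ ℓ i → v + σ * suc (ℓ + i) ≡ v + σ * ℓ + σ * suc i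
        offset = solve-∀
      near : ∑ ℓ (λ i → χ (v + σ * suc i) * 2 ^ (K ∸ i / ℓ)) ≡ 2 ^ K * count v
      near = trans (∑-cong ℓ (λ i i<ℓ → trans (cong (λ q → χ (v + σ * suc i) * 2 ^ (K ∸ q)) (m<n⇒m/n≡0 i<ℓ))
               (*-comm (χ (v + σ * suc i)) (2 ^ K)))) (∑-* ℓ (2 ^ K) (λ i → χ (v + σ * suc i)))

  module Fwd = Side 1
  module Bwd = Side n′

  -- Taking `n` blocks covers all other vertices in each direction. Going round the cycle more than
  -- once only enlarges `a` and `b`, which is harmless for the lower bound `a + b ≥ 2`.
  a b y : ℕ → ℕ
  a = Bwd.reach n
  b = Fwd.reach n
  y v = ∑ ℓ′ (λ r → χ (v + suc r))

  fwd-count : ∀ v → Fwd.count v ≡ χ (v + ℓ) + y v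
  fwd-count v = trans (∑-cong ℓ (λ r _ → cong (λ x → χ (v + x)) (*-identityˡ (suc r))))
    (trans (∑-snoc ℓ′ (λ r → χ (v + suc r))) (+-comm (y v) _))

  -- The block behind `v + ℓ` is `v, …, v + ℓ − 1`, traversed downwards; hence the reversal of the
  -- sum and the removal of multiples of `n`.
  bwd-count : ∀ v → Bwd.count (v + ℓ) ≡ χ v + y v
  bwd-count v = trans (∑-reverse ℓ (λ r → χ (v + ℓ + n′ * suc r))) (trans
    (∑-cong ℓ λ r r<ℓ → trans (cong χ (offset r (≤-pred r<ℓ))) (periodic-* χ-periodic (suc (ℓ′ ∸ r)) (v + r)))
    (cong (_+ y v) (cong χ (+-identityʳ v))))
    where
    ring : ∀ v r d n′ → v + suc (r + d) + n′ * suc d ≡ v + r + suc d * suc n′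
    ring = solve-∀
    offset : ∀ r → r ≤ ℓ′ → v + ℓ + n′ * suc (ℓ′ ∸ r) ≡ v + r + suc (ℓ′ ∸ r) * n
    offset r r≤ℓ′ = trans (cong (λ x → v + suc x + n′ * suc (ℓ′ ∸ r)) (sym (m+[n∸m]≡n r≤ℓ′))) (ring v r (ℓ′ ∸ r) n′)

  a-step : ∀ v → a (v + ℓ) ≤ ⌊ a v /2⌋ + 3 * (χ v + y v)
  a-step v = ≤-trans (Bwd.reach-suc n (v + ℓ)) (≤-reflexive (cong₂ (λ x c → ⌊ x /2⌋ + 3 * c)
    (trans (cong a (ring v ℓ n′)) (periodic-* (Bwd.reach-periodic n) ℓ v)) (bwd-count v)))
    where
    ring : ∀ v ℓ n′ → v + ℓ + n′ * ℓ ≡ v + ℓ * suc n′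
    ring = solve-∀

  b-step : ∀ v → b v ≤ ⌊ b (v + ℓ) /2⌋ + 3 * (χ (v + ℓ) + y v)
  b-step v = ≤-trans (Fwd.reach-suc n v) (≤-reflexive (cong₂ (λ x c → ⌊ x /2⌋ + 3 * c)
    (cong (λ x → b (v + x)) (*-identityˡ ℓ)) (fwd-count v)))

  -- For χ v = 0, with weights multiplied by 2 ^ n′; the dominator v + (i + 1) is credited along both arcs.
  Dominated : ℕ → Set
  Dominated v = 2 ^ n′ ≤ ∑ n′ (λ i → χ (v + suc i) * (2 ^ (n ∸ suc (i / ℓ)) + 2 ^ (n ∸ suc ((n′ ∸ suc i) / ℓ))))

  n′≤n*ℓ : n′ ≤ n * ℓ
  n′≤n*ℓ = ≤-trans (n≤1+n n′) (m≤m*n n ℓ)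

  -- Three times the total weight is at least 3, and each of the two roundings loses less than 1, so
  -- the integer `a v + b v` exceeds 1.
  dominated⇒a+b≥2 : ∀ v → Dominated v → 2 ≤ a v + b v
  dominated⇒a+b≥2 v dom = ≤-pred (≤-pred (*-cancelˡ-< (2 ^ n) 3 _ (begin-strict
    2 ^ n * 3                                        ≡⟨ six (2 ^ n′) ⟩
    6 * 2 ^ n′                                       ≤⟨ *-monoʳ-≤ 6 bound ⟩
    6 * (Fwd.scaled n v + Bwd.scaled n v)            ≡⟨ *-distribˡ-+ 6 (Fwd.scaled n v) (Bwd.scaled n v) ⟩
    6 * Fwd.scaled n v + 6 * Bwd.scaled n v          <⟨ +-mono-< (Fwd.scaled<reach n v) (Bwd.scaled<reach n v) ⟩
    2 ^ n * suc (b v) + 2 ^ n * suc (a v)            ≡⟨ collect (2 ^ n) (b v) (a v) ⟩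
    2 ^ n * suc (suc (a v + b v))                    ∎)))
    where
    open ≤-Reasoning
    six : ∀ p → 2 * p * 3 ≡ 6 * p
    six = solve-∀
    collect : ∀ p b a → p * suc b + p * suc a ≡ p * suc (suc (a + b))
    collect = solve-∀
    u : ℕ → ℕ
    u i = 2 ^ (n ∸ suc (i / ℓ))
    fwd : ∑ n′ (λ i → χ (v + suc i) * u i) ≤ Fwd.scaled n v
    fwd = ≤-trans (∑-monoˡ _ n′≤n*ℓ) (≤-reflexive (trans
      (∑-cong (n * ℓ) (λ i _ → cong (λ x → χ (v + x) * u i) (sym (*-identityˡ (suc i))))) (sym (Fwd.scaled-∑ n v))))
    ring : ∀ i d v → v + (suc i + d) * suc i ≡ v + suc d + i * suc (suc i + d)
    ring = solve-∀
    offset : ∀ i → i < n′ → v + n′ * suc i ≡ v + suc (n′ ∸ suc i) + i * n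
    offset i i<n′ = trans (cong (λ x → v + x * suc i) (sym (m+[n∸m]≡n i<n′)))
      (trans (ring i (n′ ∸ suc i) v) (cong (λ x → v + suc (n′ ∸ suc i) + i * suc x) (m+[n∸m]≡n i<n′)))
    reflect : ∀ i → i < n′ → n′ ∸ suc (n′ ∸ suc i) ≡ i
    reflect i i<n′ = trans (cong (_∸ suc (n′ ∸ suc i)) (trans (sym (m+[n∸m]≡n i<n′)) (sym (+-suc i _)))) (m+n∸n≡m i (suc (n′ ∸ suc i)))
    -- Backward offset `i + 1` is forward offset `n − (i + 1)`, so the credits along the backward
    -- arc are the forward sum reversed.
    bwd : ∑ n′ (λ i → χ (v + suc i) * u (n′ ∸ suc i)) ≤ Bwd.scaled n v
    bwd = ≤-trans (≤-reflexive (trans (∑-reverse n′ _) (∑-cong n′ (λ i i<n′ → cong₂ (λ c j → c * u j)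
        (sym (trans (cong χ (offset i i<n′)) (periodic-* χ-periodic i _))) (reflect i i<n′)))))
      (≤-trans (∑-monoˡ (λ i → χ (v + n′ * suc i) * u i) n′≤n*ℓ) (≤-reflexive (sym (Bwd.scaled-∑ n v))))
    bound : 2 ^ n′ ≤ Fwd.scaled n v + Bwd.scaled n v
    bound = ≤-trans dom (≤-trans (≤-reflexive (trans
      (∑-cong n′ (λ i _ → *-distribˡ-+ (χ (v + suc i)) (u i) (u (n′ ∸ suc i)))) (∑-+ n′ _ _))) (+-mono-≤ fwd bwd))

  ∑-shift : ∀ {f} → Periodic n f → ∀ v k → ∑ n (λ i → f (v + i + k)) ≡ ∑ n f
  ∑-shift {f} per v k = trans (∑-cong n (λ i _ → cong f (ring v i k))) (∑-rotate n per (v + k))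
    where
    ring : ∀ v i k → v + i + k ≡ v + k + i
    ring = solve-∀

  total : ℕ
  total = ∑ n χ

  ∑-y : ∀ v → ∑ n (λ i → y (v + i)) ≡ ℓ′ * total
  ∑-y v = trans (∑-swap n ℓ′ (λ i r → χ (v + i + suc r)))
    (trans (∑-cong ℓ′ (λ r _ → ∑-shift χ-periodic v (suc r))) (∑-const ℓ′ total))

  module _ (dominated : ∀ v → χ v ≡ 0 → Dominated v) where

    -- The drop of `pot a − pot b` from `v` to `v + ℓ`, with the `b` terms moved across to stay in
    -- `ℕ`.
    before after : ℕ → ℕ
    before v = pot (a v) + pot (b (v + ℓ)) + step-cost (y v) (χ v) (χ (v + ℓ))
    after  v = pot (a (v + ℓ)) + pot (b v) + 2

    after≤before : ∀ v → after v ≤ before v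
    after≤before v = step-≤ {a v} {a (v + ℓ)} {b v} {b (v + ℓ)} (y v) (χ v) (χ (v + ℓ)) (a-step v) (b-step v)
      (λ z → dominated⇒a+b≥2 v (dominated v z)) (λ z → dominated⇒a+b≥2 (v + ℓ) (dominated (v + ℓ) z))

    ∑pot : ℕ
    ∑pot = ∑ n (pot ∘ a) + ∑ n (pot ∘ b)

    a-periodic : Periodic n (pot ∘ a)
    a-periodic x = cong pot (Bwd.reach-periodic n x)

    b-periodic : Periodic n (pot ∘ b)
    b-periodic x = cong pot (Fwd.reach-periodic n x)

    -- The starting point stays free so that strictness at a given `v` can be placed at index 0 of
    -- the sum.
    ∑-after : ∀ v → ∑ n (λ i → after (v + i)) ≡ ∑pot + n * 2
    ∑-after v = trans (∑-+ n (λ i → pot (a (v + i + ℓ)) + pot (b (v + i))) (λ _ → 2))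
      (cong₂ _+_ (trans (∑-+ n (λ i → pot (a (v + i + ℓ))) (λ i → pot (b (v + i))))
        (cong₂ _+_ (∑-shift a-periodic v ℓ) (∑-rotate n b-periodic v))) (∑-const n 2))

    ∑-before : ∀ v → ∑ n (λ i → before (v + i)) ≡ ∑pot + suc (3 * ℓ) * total * 2
    ∑-before v = trans (∑-+ n (λ i → pot (a (v + i)) + pot (b (v + i + ℓ))) (λ i → step-cost (y (v + i)) (χ (v + i)) (χ (v + i + ℓ))))
      (cong₂ _+_ (trans (∑-+ n (λ i → pot (a (v + i))) (λ i → pot (b (v + i + ℓ))))
        (cong₂ _+_ (∑-rotate n a-periodic v) (∑-shift b-periodic v ℓ))) ∑-cost)
      where
      -- Each dominator is interior to `ℓ′` steps and an end of two, so it pays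
      -- `6 ℓ′ + 8 = 2 (3 ℓ + 1)`.
      ring : ∀ ℓ′ t → 6 * (ℓ′ * t) + 4 * (t + t) ≡ suc (3 * suc ℓ′) * t * 2
      ring = solve-∀
      ∑-cost : ∑ n (λ i → 6 * y (v + i) + 4 * (χ (v + i) + χ (v + i + ℓ))) ≡ suc (3 * ℓ) * total * 2
      ∑-cost = trans (∑-+ n (λ i → 6 * y (v + i)) (λ i → 4 * (χ (v + i) + χ (v + i + ℓ))))
        (trans (cong₂ _+_ (trans (∑-* n 6 (λ i → y (v + i))) (cong (6 *_) (∑-y v)))
          (trans (∑-* n 4 (λ i → χ (v + i) + χ (v + i + ℓ))) (cong (4 *_) (trans (∑-+ n (λ i → χ (v + i)) (λ i → χ (v + i + ℓ)))
            (cong₂ _+_ (∑-rotate n χ-periodic v) (∑-shift χ-periodic v ℓ))))))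
          (ring ℓ′ total))

    n≤[1+3ℓ]*total : n ≤ suc (3 * ℓ) * total
    n≤[1+3ℓ]*total = *-cancelʳ-≤ n _ 2 (+-cancelˡ-≤ ∑pot _ _ (subst₂ _≤_ (∑-after 0) (∑-before 0)
      (∑-mono n (λ i _ → after≤before i))))

    module _ (tight : suc (3 * ℓ) * total ≤ n) (2≤n : 2 ≤ n) where

      after≮before : ∀ v → ¬ (after v < before v)
      after≮before v lt = <⇒≱ (*-cancelʳ-< 2 n _ (+-cancelˡ-< ∑pot _ _ (subst₂ _<_ (∑-after v) (∑-before v)
        (∑-strict n (λ i → after≤before (v + i)) 0 (s≤s z≤n) (subst (λ x → after x < before x) (sym (+-identityʳ v)) lt))))) tight

      -- Anything positive here would make the step from the dominator `v` strict by `step-<`,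
      -- contradicting tightness.
      nothing-near : ∀ v → 1 ≤ χ v → (χ (v + ℓ) + y v) + b (v + ℓ) ≡ 0
      nothing-near v 1≤χ with (χ (v + ℓ) + y v) + b (v + ℓ) in eq
      ... | zero  = refl
      ... | suc k = ⊥-elim (after≮before v (step-< {a v} {a (v + ℓ)} {b v} {b (v + ℓ)} (y v) (χ v) (χ (v + ℓ))
        (a-step v) (b-step v) 1≤χ (subst (1 ≤_) (sym eq) (s≤s z≤n))))

      -- A dominator in the first block contributes 3, and one in the second still leaves at least 1
      -- after halving and rounding. Two blocks is the limit: a lone dominator in the third gives
      -- `⌊3/4⌋ = 0`.
      reach≡0⇒count≡0 : ∀ K v → Fwd.reach (suc (suc K)) v ≡ 0 → Fwd.count v ≡ 0 × Fwd.count (v + 1 * ℓ) ≡ 0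
      reach≡0⇒count≡0 K v eq =
        triple (m+n≡0⇒n≡0 ⌊ Fwd.reach (suc K) (v + 1 * ℓ) /2⌋ eq) ,
        half 3c≤ (m+n≡0⇒m≡0 ⌊ Fwd.reach (suc K) (v + 1 * ℓ) /2⌋ eq)
        where
        triple : ∀ {c} → 3 * c ≡ 0 → c ≡ 0
        triple {zero} _ = refl
        3c≤ : 3 * Fwd.count (v + 1 * ℓ) ≤ Fwd.reach (suc K) (v + 1 * ℓ)
        3c≤ = m≤n+m _ ⌊ Fwd.reach K (v + 1 * ℓ + 1 * ℓ) /2⌋
        half : ∀ {c r} → 3 * c ≤ r → ⌊ r /2⌋ ≡ 0 → c ≡ 0
        half {zero}  _  _ = refl
        half {suc c} le z = ⊥-elim (n≮0 (subst (1 ≤_) z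
          (⌊n/2⌋-mono (≤-trans (s≤s (s≤s z≤n)) (≤-trans (m≤m*n 3 (suc c)) le)))))

      isolated : ∀ v → 1 ≤ χ v → ∑ (3 * ℓ) (λ i → χ (v + suc i)) ≡ 0
      isolated v 1≤χ = trans (∑-blocks 3 ℓ (λ i → χ (v + suc i))) (trans (∑-cong 3 blocks) (∑-zero 3 blocks≡0))
        where
        near : (χ (v + ℓ) + y v) + b (v + ℓ) ≡ 0
        near = nothing-near v 1≤χ
        far : Fwd.count (v + ℓ) ≡ 0 × Fwd.count (v + ℓ + 1 * ℓ) ≡ 0
        -- `b` is `reach` with `n` blocks, and `2≤n` supplies the two that are inspected. Seen from
        -- `v + ℓ` they are the second and third block after `v`.
        far = reach≡0 2≤n (m+n≡0⇒n≡0 (χ (v + ℓ) + y v) near)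
          where
          reach≡0 : ∀ {K} → 2 ≤ K → Fwd.reach K (v + ℓ) ≡ 0 → Fwd.count (v + ℓ) ≡ 0 × Fwd.count (v + ℓ + 1 * ℓ) ≡ 0
          reach≡0 (s≤s (s≤s {n = K} z≤n)) = reach≡0⇒count≡0 K (v + ℓ)
        blocks : ∀ q → q < 3 → ∑ ℓ (λ r → χ (v + suc (q * ℓ + r))) ≡ Fwd.count (v + q * ℓ)
        blocks q _ = ∑-cong ℓ (λ r _ → cong χ (ring v (q * ℓ) r))
          where
          ring : ∀ v x r → v + suc (x + r) ≡ v + x + 1 * suc r
          ring = solve-∀
        blocks≡0 : ∀ q → q < 3 → Fwd.count (v + q * ℓ) ≡ 0
        blocks≡0 0 _ = trans (cong Fwd.count (+-identityʳ v)) (trans (fwd-count v) (m+n≡0⇒m≡0 _ near))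
        blocks≡0 1 _ = trans (cong (λ x → Fwd.count (v + x)) (+-identityʳ ℓ)) (proj₁ far)
        blocks≡0 2 _ = trans (cong Fwd.count (sym (+-assoc v ℓ (1 * ℓ)))) (proj₂ far)
        blocks≡0 (suc (suc (suc q))) (s≤s (s≤s (s≤s ())))

-- Distances and weights in the circulant graph

any-elim : ∀ {A : Set} (p : A → Bool) xs → T (any p xs) → ∃ λ x → x ∈ xs × T (p x)
any-elim p xs t = find (any⁻ p xs t)

any-intro : ∀ {A : Set} (p : A → Bool) {xs x} → x ∈ xs → T (p x) → T (any p xs)
any-intro p x∈xs t = any⁺ p (lose x∈xs t)

%-+-cong : ∀ x y z n .{{_ : NonZero n}} → x % n ≡ y % n → (x + z) % n ≡ (y + z) % n
%-+-cong x y z n eq = trans (%-distribˡ-+ x z n)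
  (trans (cong (λ r → (r + z % n) % n) eq) (sym (%-distribˡ-+ y z n)))

%-≡⇒∣ : ∀ x d n .{{_ : NonZero n}} → x % n ≡ (x + d) % n → n ∣ d
%-≡⇒∣ x d n eq = ∣m+n∣m⇒∣n (divides ((x + d) / n) (+-cancelˡ-≡ (x % n) _ _ sum≡)) (divides (x / n) refl)
  where
  open ≡-Reasoning
  sum≡ : x % n + (x / n * n + d) ≡ x % n + (x + d) / n * n
  sum≡ = begin
    x % n + (x / n * n + d)             ≡⟨ sym (+-assoc (x % n) _ d) ⟩
    x % n + x / n * n + d               ≡⟨ cong (_+ d) (sym (m≡m%n+[m/n]*n x n)) ⟩
    x + d                               ≡⟨ m≡m%n+[m/n]*n (x + d) n ⟩
    (x + d) % n + (x + d) / n * n       ≡⟨ cong (_+ (x + d) / n * n) (sym eq) ⟩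
    x % n + (x + d) / n * n             ∎

mutual
  -- The summation local to the definition of weight, recovered by unification.
  sumFin : (N ℓ : ℕ) .{{_ : NonZero N}} (D : Subset N) (v : Fin N) (m : ℕ) → (Fin m → ℚ) → ℚ
  sumFin = _

  weight-suc : ∀ n ℓ .{{nz : NonZero (suc n)}} (D : Subset (suc n)) (v : Fin (suc n)) →
    weight (suc n) ℓ {{nz}} D v ≡
    (if lookup D Fin.zero then halfPow (dist (suc n) ℓ {{nz}} Fin.zero v) else 0ℚ) +ℚ
    sumFin (suc n) ℓ {{nz}} D v n
      (λ d → if lookup D (Fin.suc d) then halfPow (dist (suc n) ℓ {{nz}} (Fin.suc d) v) else 0ℚ)
  weight-suc n ℓ {{nz}} D v
    with if lookup D Fin.zero then halfPow (dist (suc n) ℓ {{nz}} Fin.zero v) else 0ℚ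
       | (λ (d : Fin n) → if lookup D (Fin.suc d) then halfPow (dist (suc n) ℓ {{nz}} (Fin.suc d) v) else 0ℚ)
  -- Abstracting suc n separates the index of the summation from the parameters of weight.
  ... | x | g with suc n
  ... | N = refl

-- Once all terms are natural multiples of one unit `u`, the rational sum becomes a sum in `ℕ`,
-- where the discharging takes place.
sumFin-∑ : ∀ {N ℓ} .{{_ : NonZero N}} {D : Subset N} {v : Fin N} {m} {f : Fin m → ℚ} {g : ℕ → ℕ} {u : ℚ} →
  (∀ i → f i ≡ g (toℕ i) · u) → sumFin N ℓ D v m f ≡ ∑ m g · u
sumFin-∑ {m = zero}  h = refl
sumFin-∑ {N} {ℓ} {D} {v} {suc m} {f} {g} {u} h =
  trans (cong₂ _+ℚ_ (h Fin.zero) (sumFin-∑ {N} {ℓ} {D} {v} {m} {f ∘ Fin.suc} {g ∘ suc} (h ∘ Fin.suc)))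
        (sym (·-homo-+ u (g 0) (∑ m (g ∘ suc))))

halfPow-double : ∀ k → halfPow k ≡ halfPow (suc k) +ℚ halfPow (suc k)
halfPow-double zero    = refl
halfPow-double (suc k) = trans (sym (ℚ.*-identityˡ h)) (ℚ.*-distribʳ-+ h ½ ½)
  where
  h : ℚ
  h = halfPow (suc k)

halfPow-+ : ∀ k j → halfPow k ≡ (2 ^ j) · halfPow (k + j)
halfPow-+ k zero = trans (cong halfPow (sym (+-identityʳ k))) (sym (ℚ.+-identityʳ _))
halfPow-+ k (suc j) = trans (halfPow-double k) (trans (cong₂ _+ℚ_ ih ih)
  (trans (sym (·-homo-+ h (2 ^ j) (2 ^ j))) (cong (λ x → (2 ^ j + x) · h) (sym (+-identityʳ (2 ^ j))))))
  where
  h : ℚ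
  h = halfPow (k + suc j)
  ih : halfPow (suc k) ≡ (2 ^ j) · h
  ih = trans (halfPow-+ (suc k) j) (cong (λ x → (2 ^ j) · halfPow x) (sym (+-suc k j)))

halfPow-scale : ∀ {k n} → k ≤ n → halfPow k ≡ (2 ^ (n ∸ k)) · halfPow n
halfPow-scale {k} {n} k≤n = trans (halfPow-+ k (n ∸ k)) (cong (λ x → (2 ^ (n ∸ k)) · halfPow x) (m+[n∸m]≡n k≤n))

halfPow-pos : ∀ k → 0ℚ <ℚ halfPow k
halfPow-pos zero          = toWitness {a? = 0ℚ ℚ.<? halfPow 0} _
halfPow-pos (suc zero)    = toWitness {a? = 0ℚ ℚ.<? halfPow 1} _
halfPow-pos (suc (suc k)) = subst (_<ℚ halfPow (suc (suc k))) (ℚ.*-zeroʳ ½) (ℚ.*-monoʳ-<-pos ½ (halfPow-pos (suc k)))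

·-mono-≤ : ∀ {u m n} → 0ℚ ≤ℚ u → m ≤ n → m · u ≤ℚ n · u
·-mono-≤ {n = zero}  0≤u z≤n = ℚ.≤-refl
·-mono-≤ {u} {n = suc n} 0≤u z≤n = ℚ.+-mono-≤ 0≤u (·-mono-≤ {u} {0} {n} 0≤u z≤n)
·-mono-≤ {u} 0≤u (s≤s m≤n) = ℚ.+-monoʳ-≤ u (·-mono-≤ 0≤u m≤n)

·-cancel-≤ : ∀ {u} m n → 0ℚ <ℚ u → m · u ≤ℚ n · u → m ≤ n
·-cancel-≤ {u} m n 0<u le with m ≤? n
... | yes m≤n = m≤n
... | no  m≰n = contradiction (ℚ.<-≤-trans n·u<m·u le) (ℚ.<-irrefl refl)
  where
  n·u<m·u : n · u <ℚ m · u
  n·u<m·u = ℚ.<-≤-trans (subst (_<ℚ suc n · u) (ℚ.+-identityˡ _) (ℚ.+-monoˡ-< (n · u) 0<u))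
                        (·-mono-≤ (ℚ.<⇒≤ 0<u) (≰⇒> m≰n))

bit : Bool → ℕ
bit b = if b then 1 else 0

card-∑ : ∀ {n} (D : Subset n) {g : ℕ → ℕ} → (∀ i → g (toℕ i) ≡ bit (lookup D i)) → ∣ D ∣ ≡ ∑ n g
card-∑ []          h = refl
card-∑ (true ∷ D)  h = cong₂ _+_ (sym (h Fin.zero)) (card-∑ D (h ∘ Fin.suc))
card-∑ (false ∷ D) h = cong₂ _+_ (sym (h Fin.zero)) (card-∑ D (h ∘ Fin.suc))

bit≤1 : ∀ x → bit x ≤ 1
bit≤1 true  = ≤-refl
bit≤1 false = z≤n

T⇒bit : ∀ {x} → T x → bit x ≡ 1
T⇒bit {true} _ = refl

¬T⇒bit : ∀ {x} → ¬ T x → bit x ≡ 0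
¬T⇒bit {true}  h = ⊥-elim (h tt)
¬T⇒bit {false} h = refl

bit⇒T : ∀ {x} → 1 ≤ bit x → T x
bit⇒T {true} _ = tt

bit-∧ : ∀ x y → bit (x ∧ y) ≡ bit x * bit y
bit-∧ true  y = sym (+-identityʳ (bit y))
bit-∧ false y = refl

T-ext : ∀ {x y} → (T x → T y) → (T y → T x) → x ≡ y
T-ext {true}  {true}  f g = refl
T-ext {true}  {false} f g = ⊥-elim (f tt)
T-ext {false} {true}  f g = ⊥-elim (g tt)
T-ext {false} {false} f g = refl

module Circulant (n′ ℓ′ : ℕ) where
  n ℓ : ℕ
  n = suc n′
  ℓ = suc ℓ′

  toℕ-mod-% : ∀ x → toℕ (x mod n) ≡ x % n
  toℕ-mod-% x = toℕ-fromℕ< _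

  toℕ-mod-+ : ∀ x z → (toℕ (x mod n) + z) % n ≡ (x + z) % n
  toℕ-mod-+ x z = %-+-cong (toℕ (x mod n)) x z n (trans (cong (_% n) (toℕ-mod-% x)) (m%n%n≡m%n x n))

  mod-cong : ∀ {x y} → x % n ≡ y % n → x mod n ≡ y mod n
  mod-cong {x} {y} eq = toℕ-injective (trans (toℕ-mod-% x) (trans eq (sym (toℕ-mod-% y))))

  -- Total forward displacement `p` and backward displacement `q` of a walk, kept on separate sides
  -- to avoid subtraction modulo `n`.
  Within : ℕ → Fin n → Fin n → Set
  Within r u v = ∃₂ λ p q → p + q ≤ r × (toℕ u + p) % n ≡ (toℕ v + q) % n

  within-≡ : ∀ (u v : Fin n) i → toℕ v ≡ (toℕ u + i) % n → (toℕ u + i) % n ≡ (toℕ v + 0) % n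
  within-≡ u v i eq = trans (sym (m%n%n≡m%n (toℕ u + i) n))
    (trans (cong (_% n) (sym eq)) (cong (_% n) (sym (+-identityʳ (toℕ v)))))

  adj⇒within : ∀ u v → T (adj n ℓ u v) → Within ℓ u v
  adj⇒within u v t with any-elim _ (map suc (upTo ℓ)) t
  ... | i , i∈ , h with ∈-map⁻ suc i∈
  ... | j , j∈ , refl with Equivalence.to (T-∨ {toℕ v ≡ᵇ (toℕ u + suc j) % n}) h
  ... | inj₁ eq = suc j , 0 , ≤-trans (≤-reflexive (+-identityʳ (suc j))) (∈-upTo⁻ j∈) , within-≡ u v (suc j) (≡ᵇ⇒≡ (toℕ v) _ eq)
  ... | inj₂ eq = 0 , suc j , ∈-upTo⁻ j∈ , sym (within-≡ v u (suc j) (≡ᵇ⇒≡ (toℕ u) _ eq))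

  within-trans : ∀ {r s} u v w → Within r u v → Within s v w → Within (s + r) u w
  within-trans u v w (p , q , p+q≤r , eq) (p′ , q′ , p′+q′≤s , eq′) =
    p + p′ , q′ + q , ≤-trans (≤-reflexive (ring p p′ q q′)) (+-mono-≤ p′+q′≤s p+q≤r) ,
    trans (cong (_% n) (sym (+-assoc (toℕ u) p p′))) (trans (%-+-cong (toℕ u + p) (toℕ v + q) p′ n eq)
      (trans (cong (_% n) (swap (toℕ v) q p′)) (trans (%-+-cong (toℕ v + p′) (toℕ w + q′) q n eq′) (cong (_% n) (+-assoc (toℕ w) q′ q)))))
    where
    ring : ∀ p p′ q q′ → p + p′ + (q′ + q) ≡ p′ + q′ + (p + q)
    ring = solve-∀
    swap : ∀ v q p → v + q + p ≡ v + p + q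
    swap = solve-∀

  ball⇒within : ∀ k u v → T (ball n ℓ k u v) → Within (k * ℓ) u v
  ball⇒within zero u v t with toWitness t
  ... | refl = 0 , 0 , z≤n , refl
  ball⇒within (suc k) u v t with Equivalence.to T-∨ t
  ... | inj₁ t′ with ball⇒within k u v t′
  ...   | p , q , le , eq = p , q , ≤-trans le (m≤n+m _ ℓ) , eq
  ball⇒within (suc k) u v t | inj₂ t′ with any-elim _ (allFin n) t′
  ... | w , _ , h with Equivalence.to T-∧ h
  ... | h₁ , h₂ = within-trans u w v (ball⇒within k u w h₁) (adj⇒within w v h₂)

  search-sound : ∀ u v k fuel → T (ball n ℓ (search n ℓ u v k fuel) u v) ⊎ search n ℓ u v k fuel ≡ k + fuel
  search-sound u v k zero = inj₂ (sym (+-identityʳ k))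
  search-sound u v k (suc fuel) with ball n ℓ k u v in eq
  ... | true  = inj₁ (subst T (sym eq) tt)
  ... | false = [ inj₁ , (λ e → inj₂ (trans e (sym (+-suc k fuel)))) ]′ (search-sound u v (suc k) fuel)

  search-≤ : ∀ u v k fuel → search n ℓ u v k fuel ≤ k + fuel
  search-≤ u v k zero = m≤m+n k 0
  search-≤ u v k (suc fuel) with ball n ℓ k u v
  ... | true  = m≤m+n k (suc fuel)
  ... | false = subst (search n ℓ u v (suc k) fuel ≤_) (sym (+-suc k fuel)) (search-≤ u v (suc k) fuel)

  search-minimal : ∀ u v {r} k fuel → k ≤ r → r ≤ k + fuel → T (ball n ℓ r u v) → search n ℓ u v k fuel ≤ r
  search-minimal u v k zero k≤r _ _ = k≤r
  search-minimal u v {r} k (suc fuel) k≤r r≤ t with ball n ℓ k u v in eq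
  ... | true = k≤r
  ... | false = search-minimal u v (suc k) fuel (≤∧≢⇒< k≤r k≢r) (≤-trans r≤ (≤-reflexive (+-suc k fuel))) t
    where
    k≢r : k ≢ r
    k≢r refl = subst T eq t

  -- A walk of `k` edges moves at most `k * ℓ` in total. Either its backward part covers the arc of
  -- length `i + 1`, or the surplus `suc i + p ∸ q` is a positive multiple of `n` and its forward
  -- part covers the other arc. The bounds are the arc lengths divided by `ℓ`, rounded up.
  dist-lower : ∀ v i → i < n′ → let d = dist n ℓ ((v + suc i) mod n) (v mod n) in
               suc (i / ℓ) ≤ d ⊎ suc ((n′ ∸ suc i) / ℓ) ≤ d
  dist-lower v i i<n′ with search-sound ((v + suc i) mod n) (v mod n) 0 n
  -- The default `n` of an exhausted search also exceeds `i / ℓ`.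
  ... | inj₂ eq = inj₁ (subst (suc (i / ℓ) ≤_) (sym eq) (s≤s (≤-trans (m/n≤m i ℓ) (<⇒≤ i<n′))))
  ... | inj₁ t with ball⇒within (dist n ℓ ((v + suc i) mod n) (v mod n)) _ _ t
  ...   | p , q , p+q≤kℓ , eq = go (≤-total (suc i + p) q)
    where
    k : ℕ
    k = dist n ℓ ((v + suc i) mod n) (v mod n)
    eq′ : (v + (suc i + p)) % n ≡ (v + q) % n
    eq′ = trans (cong (_% n) (sym (+-assoc v (suc i) p)))
      (trans (sym (toℕ-mod-+ (v + suc i) p)) (trans eq (toℕ-mod-+ v q)))
    go : suc i + p ≤ q ⊎ q ≤ suc i + p → suc (i / ℓ) ≤ k ⊎ suc ((n′ ∸ suc i) / ℓ) ≤ k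
    go (inj₁ le) = inj₁ (m<n*o⇒m/o<n (≤-trans (m≤m+n (suc i) p) (≤-trans le (≤-trans (m≤n+m q p) p+q≤kℓ))))
    go (inj₂ le) with suc i + p ∸ q in eqδ
    ... | zero  = inj₁ (m<n*o⇒m/o<n (≤-trans (m≤m+n (suc i) p) (≤-trans (m∸n≡0⇒m≤n eqδ) (≤-trans (m≤n+m q p) p+q≤kℓ))))
    ... | suc δ = inj₂ (m<n*o⇒m/o<n (≤-trans (≤-reflexive (sym (+-∸-assoc 1 i<n′))) (≤-trans n′∸i≤p (≤-trans (m≤m+n p q) p+q≤kℓ))))
      where
      δ≡ : q + suc δ ≡ suc i + p
      δ≡ = trans (cong (q +_) (sym eqδ)) (m+[n∸m]≡n le)
      n∣δ : n ∣ suc δ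
      n∣δ = %-≡⇒∣ (v + q) (suc δ) n (trans (sym eq′) (cong (_% n) (trans (cong (v +_) (sym δ≡)) (sym (+-assoc v q (suc δ))))))
      n≤ : n ≤ suc i + p
      n≤ = ≤-trans (∣⇒≤ n∣δ) (≤-trans (m≤n+m (suc δ) q) (≤-reflexive δ≡))
      n′∸i≤p : n′ ∸ i ≤ p
      n′∸i≤p = m≤n+o⇒m∸n≤o n′ i (≤-pred n≤)

  adj-fwd : ∀ x i → i < ℓ → T (adj n ℓ (x mod n) ((x + suc i) mod n))
  adj-fwd x i i<ℓ = any-intro _ (∈-map⁺ suc (∈-upTo⁺ i<ℓ)) (Equivalence.from T-∨ (inj₁ 
    (≡⇒≡ᵇ _ _ (trans (toℕ-mod-% (x + suc i)) (sym (toℕ-mod-+ x (suc i)))))))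

  adj-sym : ∀ u v → T (adj n ℓ u v) → T (adj n ℓ v u)
  adj-sym u v t with any-elim _ (map suc (upTo ℓ)) t
  ... | i , i∈ , h = any-intro _ i∈ (subst T (∨-comm (toℕ v ≡ᵇ (toℕ u + i) % n) (toℕ u ≡ᵇ (toℕ v + i) % n)) h)

  ball-refl : ∀ u → T (ball n ℓ 0 u u)
  ball-refl u = fromWitness refl

  ball-adj : ∀ {k u v w} → T (ball n ℓ k u v) → T (adj n ℓ v w) → T (ball n ℓ (suc k) u w)
  ball-adj {k} {u} {v} {w} t s = Equivalence.from (T-∨ {ball n ℓ k u w}) (inj₂ (any-intro _ (∈-allFin v) (Equivalence.from T-∧ (t , s))))

  dist-≤ : ∀ {u v k} → k ≤ n → T (ball n ℓ k u v) → dist n ℓ u v ≤ k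
  dist-≤ {u} {v} k≤n = search-minimal u v 0 n z≤n k≤n

  ball-suc : ∀ {u v} k → T (ball n ℓ k u v) → T (ball n ℓ (suc k) u v)
  ball-suc {u} {v} k t = Equivalence.from (T-∨ {ball n ℓ k u v}) (inj₁ t)

  -- Full jumps of length `ℓ` come first; the last jump covers the remainder `suc r`.
  ball-fwd : ∀ k x i → i ≤ k * ℓ → T (ball n ℓ k (x mod n) ((x + i) mod n))
  ball-fwd zero    x .zero z≤n = subst (λ z → T (ball n ℓ 0 (x mod n) (z mod n))) (sym (+-identityʳ x)) (ball-refl (x mod n))
  ball-fwd (suc k) x i i≤ with i ≤? k * ℓ
  ... | yes i≤kℓ = ball-suc k (ball-fwd k x i i≤kℓ)
  ... | no  i≰kℓ = subst (λ z → T (ball n ℓ (suc k) (x mod n) (z mod n))) split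
    (ball-adj {k} (ball-fwd k x (k * ℓ) ≤-refl) (adj-fwd (x + k * ℓ) r r<ℓ))
    where
    r : ℕ
    r = i ∸ suc (k * ℓ)
    i≡ : suc (k * ℓ) + r ≡ i
    i≡ = m+[n∸m]≡n (≰⇒> i≰kℓ)
    split : x + k * ℓ + suc r ≡ x + i
    split = trans (+-assoc x (k * ℓ) (suc r)) (cong (x +_) (trans (+-suc (k * ℓ) r) i≡))
    r<ℓ : r < ℓ
    r<ℓ = +-cancelˡ-≤ (k * ℓ) _ _ (≤-trans (≤-reflexive (trans (+-suc (k * ℓ) r) i≡)) (≤-trans i≤ (≤-reflexive (+-comm ℓ (k * ℓ)))))

  ball-bwd : ∀ k x i → i ≤ k * ℓ → T (ball n ℓ k ((x + i) mod n) (x mod n))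
  ball-bwd zero    x .zero z≤n = subst (λ z → T (ball n ℓ 0 (z mod n) (x mod n))) (sym (+-identityʳ x)) (ball-refl (x mod n))
  ball-bwd (suc k) x i i≤ with i ≤? k * ℓ
  ... | yes i≤kℓ = ball-suc k (ball-bwd k x i i≤kℓ)
  ... | no  i≰kℓ = subst (λ z → T (ball n ℓ (suc k) (z mod n) (x mod n))) split
    (ball-adj {k} (ball-bwd k (x + suc r) (k * ℓ) ≤-refl) (adj-sym (x mod n) ((x + suc r) mod n) (adj-fwd x r r<ℓ)))
    where
    r : ℕ
    r = i ∸ suc (k * ℓ)
    i≡ : suc (k * ℓ) + r ≡ i
    i≡ = m+[n∸m]≡n (≰⇒> i≰kℓ)
    split : x + suc r + k * ℓ ≡ x + i
    split = trans (+-assoc x (suc r) (k * ℓ)) (cong (x +_) (trans (+-comm (suc r) (k * ℓ)) (trans (+-suc (k * ℓ) r) i≡)))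
    r<ℓ : r < ℓ
    r<ℓ = +-cancelˡ-≤ (k * ℓ) _ _ (≤-trans (≤-reflexive (trans (+-suc (k * ℓ) r) i≡)) (≤-trans i≤ (≤-reflexive (+-comm ℓ (k * ℓ)))))

  toℕ-mod : ∀ (i : Fin n) → toℕ i mod n ≡ i
  toℕ-mod i = toℕ-injective (trans (toℕ-fromℕ< _) (m<n⇒m%n≡m (toℕ<n i)))

  -- The weight of a single dominator in units of `halfPow n`; the threshold `1ℚ` becomes `2 ^ n′`.
  influence : ℕ → Fin n → ℕ
  influence x v = 2 ^ (n ∸ dist n ℓ (x mod n) v)

  indicator : Subset n → ℕ → ℕ
  indicator D x = bit (lookup D (x mod n))

  card-indicator : ∀ D → ∣ D ∣ ≡ ∑ n (indicator D)
  card-indicator D = card-∑ D {indicator D} (λ i → cong (bit ∘ lookup D) (toℕ-mod i))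

  weight-∑ : ∀ D v → weight n ℓ D v ≡ ∑ n (λ i → indicator D i * influence i v) · halfPow n
  weight-∑ D v = trans (weight-suc n′ ℓ D v)
    (sumFin-∑ {n} {ℓ} {D} {v} {n} {λ d → if lookup D d then halfPow (dist n ℓ d v) else 0ℚ} {λ i → indicator D i * influence i v} term)
    where
    term : ∀ d → (if lookup D d then halfPow (dist n ℓ d v) else 0ℚ) ≡ (indicator D (toℕ d) * influence (toℕ d) v) · halfPow n
    term d rewrite toℕ-mod d with lookup D d
    ... | true  = trans (halfPow-scale (search-≤ d v 0 n)) (cong (_· halfPow n) (sym (*-identityˡ (2 ^ (n ∸ dist n ℓ d v)))))
    ... | false = refl

  1ℚ-scale : 1ℚ ≡ (2 ^ n′) · halfPow n
  1ℚ-scale = halfPow-scale {1} {n} (s≤s z≤n)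

  PED⇒ : ∀ D → IsPED n ℓ D → ∀ v → 2 ^ n′ ≤ ∑ n (λ i → indicator D i * influence i v)
  PED⇒ D ped v = ·-cancel-≤ (2 ^ n′) _ (halfPow-pos n) (subst₂ _≤ℚ_ 1ℚ-scale (weight-∑ D v) (ped v))

  ⇒PED : ∀ D → (∀ v → 2 ^ n′ ≤ ∑ n (λ i → indicator D i * influence i v)) → IsPED n ℓ D
  ⇒PED D h v = subst₂ _≤ℚ_ (sym 1ℚ-scale) (sym (weight-∑ D v)) (·-mono-≤ (ℚ.<⇒≤ (halfPow-pos n)) (h v))

  influence-≥ : ∀ k x v → k ≤ n → T (ball n ℓ k (x mod n) v) → 2 ^ (n ∸ k) ≤ influence x v
  influence-≥ k x v k≤n t = ^-monoʳ-≤ 2 (∸-monoʳ-≤ n (dist-≤ {x mod n} {v} k≤n t))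

  mod-periodic : Periodic n (_mod n)
  mod-periodic x = mod-cong {x + n} {x} ([m+n]%n≡m%n x n)

  indicator-periodic : ∀ D → Periodic n (indicator D)
  indicator-periodic D x = cong (bit ∘ lookup D) (mod-periodic x)

  -- progression n c L m and interval n a len are images by definition.
  image : (ℕ → ℕ) → ℕ → Subset n
  image h k = tabulate (λ v → any (λ t → toℕ v ≡ᵇ h t) (upTo k))

  T-image⁺ : ∀ h k v → (∃ λ t → t < k × toℕ v ≡ h t) → T (lookup (image h k) v)
  T-image⁺ h k v (t , t<k , eq) = subst T (sym (lookup∘tabulate (λ v → any (λ t → toℕ v ≡ᵇ h t) (upTo k)) v))
    (any-intro (λ t → toℕ v ≡ᵇ h t) (∈-upTo⁺ t<k) (≡⇒≡ᵇ (toℕ v) _ eq))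

  T-image⁻ : ∀ h k v → T (lookup (image h k) v) → ∃ λ t → t < k × toℕ v ≡ h t
  T-image⁻ h k v p with any-elim (λ t → toℕ v ≡ᵇ h t) (upTo k)
                          (subst T (lookup∘tabulate (λ v → any (λ t → toℕ v ≡ᵇ h t) (upTo k)) v) p)
  ... | t , t∈ , eq = t , ∈-upTo⁻ t∈ , ≡ᵇ⇒≡ (toℕ v) _ eq

-- The progression of step `3ℓ + 1`, and minimum sets compared with it.

module Spacing (n′ ℓ′ m : ℕ) (n≡ : suc n′ ≡ suc (3 * suc ℓ′) * m) (2≤m : 2 ≤ m) where
  open Circulant n′ ℓ′

  L : ℕ
  L = suc (3 * ℓ)

  n≡mL : n ≡ m * L
  n≡mL = trans n≡ (*-comm L m)

  L<n : L < n
  L<n = ≤-trans (m<m+n L {L + 0} (s≤s z≤n)) (≤-trans (*-monoˡ-≤ L 2≤m) (≤-reflexive (sym n≡mL)))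

  2≤n : 2 ≤ n
  2≤n = ≤-trans (s≤s (s≤s z≤n)) L<n

  -- Summation starts at `v`, whose own term vanishes. Every other distance is bounded below by one
  -- of the two arcs, so crediting both arcs can only increase the sum.
  dominated : ∀ D → IsPED n ℓ D → let open Discharging n′ ℓ′ (indicator D) (indicator-periodic D) in
              ∀ v → indicator D v ≡ 0 → Dominated v
  dominated D ped v χv≡0 = begin
    2 ^ n′                                        ≤⟨ PED⇒ D ped (v mod n) ⟩
    ∑ n f                                         ≡⟨ sym (∑-rotate n f-periodic v) ⟩
    f (v + 0) + ∑ n′ (λ i → f (v + suc i))        ≡⟨ cong (_+ ∑ n′ (λ i → f (v + suc i))) f0≡0 ⟩
    ∑ n′ (λ i → f (v + suc i))                    ≤⟨ ∑-mono n′ (λ i i<n′ → *-monoʳ-≤ (indicator D (v + suc i)) (bound i i<n′)) ⟩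
    _                                             ∎
    where
    open ≤-Reasoning
    f : ℕ → ℕ
    f i = indicator D i * influence i (v mod n)
    f-periodic : Periodic n f
    f-periodic x = cong₂ _*_ (indicator-periodic D x)
      (cong (λ u → 2 ^ (n ∸ dist n ℓ u (v mod n))) (mod-periodic x))
    f0≡0 : f (v + 0) ≡ 0
    f0≡0 = cong (_* influence (v + 0) (v mod n)) (trans (cong (indicator D) (+-identityʳ v)) χv≡0)
    bound : ∀ i → i < n′ → influence (v + suc i) (v mod n) ≤ 2 ^ (n ∸ suc (i / ℓ)) + 2 ^ (n ∸ suc ((n′ ∸ suc i) / ℓ))
    bound i i<n′ with dist-lower v i i<n′
    ... | inj₁ le = ≤-trans (^-monoʳ-≤ 2 (∸-monoʳ-≤ n le)) (m≤m+n _ _)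
    ... | inj₂ le = ≤-trans (^-monoʳ-≤ 2 (∸-monoʳ-≤ n le)) (m≤n+m _ (2 ^ (n ∸ suc (i / ℓ))))

  m-nonZero : NonZero m
  m-nonZero = >-nonZero (≤-trans (s≤s z≤n) 2≤m)

  reduce : ∀ c t → ∃ λ t′ → t′ < m × (c + L * t) % n ≡ (c + L * t′) % n
  reduce c t = t % m , m%n<n t m , trans (cong (_% n) split) ([m+kn]%n≡m%n (c + L * (t % m)) (t / m) n)
    where
    instance _ = m-nonZero
    ring : ∀ c L r q m → c + L * (r + q * m) ≡ c + L * r + q * (L * m)
    ring = solve-∀
    split : c + L * t ≡ c + L * (t % m) + t / m * n
    split = trans (cong (λ x → c + L * x) (m≡m%n+[m/n]*n t m)) (trans (ring c L (t % m) (t / m) m)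
      (cong (λ x → c + L * (t % m) + t / m * x) (sym n≡)))

  prog₀ : Subset n
  prog₀ = progression n Fin.zero L m

  prog₀-∈ : ∀ t → indicator prog₀ (t * L) ≡ 1
  prog₀-∈ t with reduce 0 t
  ... | t′ , t′<m , eq = T⇒bit (T-image⁺ (λ t → (L * t) % n) m ((t * L) mod n)
    (t′ , t′<m , trans (toℕ-mod-% (t * L)) (trans (cong (_% n) (*-comm t L)) eq)))

  -- Both numbers lie below `n`, so the congruence modulo `n` is an equality; its residues modulo
  -- `L` are `suc j` and 0.
  prog₀-∉ : ∀ i j → i < m → j < 3 * ℓ → indicator prog₀ (i * L + suc j) ≡ 0
  prog₀-∉ i j i<m j<3ℓ = ¬T⇒bit λ h → absurd (T-image⁻ (λ t → (L * t) % n) m ((i * L + suc j) mod n) h)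
    where
    x<n : i * L + suc j < n
    x<n = ≤-trans (≤-reflexive (sym (+-suc (i * L) (suc j)))) (≤-trans (+-monoʳ-≤ (i * L) (s≤s j<3ℓ))
      (≤-trans (≤-reflexive (+-comm (i * L) L)) (≤-trans (*-monoˡ-≤ L i<m) (≤-reflexive (sym n≡mL)))))
    absurd : (∃ λ t → t < m × toℕ ((i * L + suc j) mod n) ≡ (L * t) % n) → ⊥
    absurd (t , t<m , eq) = 1+n≢0 (begin
      suc j                      ≡⟨ sym (m<n⇒m%n≡m (s≤s j<3ℓ)) ⟩
      suc j % L                  ≡⟨ sym ([m+kn]%n≡m%n (suc j) i L) ⟩
      (suc j + i * L) % L        ≡⟨ cong (_% L) (+-comm (suc j) (i * L)) ⟩
      (i * L + suc j) % L        ≡⟨ cong (_% L) x≡ ⟩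
      (t * L) % L                ≡⟨ m*n%n≡0 t L ⟩
      0                          ∎)
      where
      open ≡-Reasoning
      tL<n : t * L < n
      tL<n = ≤-trans (*-monoˡ-< L t<m) (≤-reflexive (sym n≡mL))
      x≡ : i * L + suc j ≡ t * L
      x≡ = begin
        i * L + suc j                      ≡⟨ sym (m<n⇒m%n≡m x<n) ⟩
        (i * L + suc j) % n                ≡⟨ sym (toℕ-mod-% (i * L + suc j)) ⟩
        toℕ ((i * L + suc j) mod n)        ≡⟨ eq ⟩
        (L * t) % n                        ≡⟨ cong (_% n) (*-comm L t) ⟩
        (t * L) % n                        ≡⟨ m<n⇒m%n≡m tL<n ⟩
        t * L                              ∎

  ∣prog₀∣≤m : ∣ prog₀ ∣ ≤ m
  ∣prog₀∣≤m = begin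
    ∣ prog₀ ∣                                                  ≡⟨ card-indicator prog₀ ⟩
    ∑ n (indicator prog₀)                                      ≡⟨ cong (λ k → ∑ k (indicator prog₀)) n≡mL ⟩
    ∑ (m * L) (indicator prog₀)                                ≡⟨ ∑-blocks m L (indicator prog₀) ⟩
    ∑ m (λ i → ∑ L (λ j → indicator prog₀ (i * L + j)))        ≤⟨ ∑-mono m block≤1 ⟩
    ∑ m (λ _ → 1)                                              ≡⟨ trans (∑-const m 1) (*-identityʳ m) ⟩
    m                                                          ∎
    where
    open ≤-Reasoning
    block≤1 : ∀ i → i < m → ∑ L (λ j → indicator prog₀ (i * L + j)) ≤ 1
    block≤1 i i<m = ≤-trans (≤-reflexive (trans (cong (indicator prog₀ (i * L + 0) +_)
      (∑-zero (3 * ℓ) (λ j j<3ℓ → prog₀-∉ i j i<m j<3ℓ))) (+-identityʳ _))) (bit≤1 _)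

  2^n′ : 2 ^ (n ∸ 2) + 2 ^ (n ∸ 2) ≡ 2 ^ n′
  2^n′ = halves n′ (≤-pred 2≤n)
    where
    halves : ∀ k → 1 ≤ k → 2 ^ (k ∸ 1) + 2 ^ (k ∸ 1) ≡ 2 ^ k
    halves (suc k) _ = cong (2 ^ k +_) (sym (+-identityʳ (2 ^ k)))

  -- A vertex at offset r from the progression sees a dominator at distance at most 1
  -- unless ℓ < r ≤ 2ℓ, where both neighbouring dominators are at distance 2.
  prog₀-PED : IsPED n ℓ prog₀
  -- Rotation puts the dominators on either side of `v` at indices 0 and `L`; they are different
  -- vertices because `L < n`.
  prog₀-PED = ⇒PED prog₀ λ v → ≤-trans (near v) (≤-trans (two-terms≤∑ n (λ i → f v (t v * L + i)) {3 * ℓ} L<n)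
    (≤-reflexive (∑-rotate n (f-periodic v) (t v * L))))
    where
    t r : Fin n → ℕ
    t v = toℕ v / L
    r v = toℕ v % L
    f : Fin n → ℕ → ℕ
    f v i = indicator prog₀ i * influence i v
    f-periodic : ∀ v → Periodic n (f v)
    f-periodic v x = cong₂ _*_ (indicator-periodic prog₀ x)
      (cong (λ u → 2 ^ (n ∸ dist n ℓ u v)) (mod-periodic x))
    v≡ : ∀ v → t v * L + r v ≡ toℕ v
    v≡ v = trans (+-comm (t v * L) (r v)) (sym (m≡m%n+[m/n]*n (toℕ v) L))
    r≤L : ∀ v → r v ≤ L
    r≤L v = m%n≤n (toℕ v) L
    right≡ : ∀ v → toℕ v + (L ∸ r v) ≡ t v * L + L
    right≡ v = trans (cong (_+ (L ∸ r v)) (sym (v≡ v))) (trans (+-assoc (t v * L) (r v) _)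
      (cong (t v * L +_) (m+[n∸m]≡n (r≤L v))))
    left : ∀ v k → k ≤ n → r v ≤ k * ℓ → 2 ^ (n ∸ k) ≤ f v (t v * L + 0)
    left v k k≤n r≤ = subst (2 ^ (n ∸ k) ≤_) (cong (f v) (sym (+-identityʳ (t v * L))))
      (≤-trans (influence-≥ k (t v * L) v k≤n
        (subst (λ u → T (ball n ℓ k ((t v * L) mod n) u)) (trans (cong (_mod n) (v≡ v)) (toℕ-mod v))
          (ball-fwd k (t v * L) (r v) r≤)))
        (≤-reflexive (sym (trans (cong (_* influence (t v * L) v) (prog₀-∈ (t v))) (*-identityˡ _)))))
    right : ∀ v k → k ≤ n → L ∸ r v ≤ k * ℓ → 2 ^ (n ∸ k) ≤ f v (t v * L + L)
    right v k k≤n r≤ = ≤-trans (influence-≥ k (t v * L + L) v k≤n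
        (subst₂ (λ x u → T (ball n ℓ k (x mod n) u)) (right≡ v) (toℕ-mod v) (ball-bwd k (toℕ v) (L ∸ r v) r≤)))
        (≤-reflexive (sym (trans (cong (_* influence (t v * L + L) v)
          (trans (cong (indicator prog₀) (+-comm (t v * L) L)) (prog₀-∈ (suc (t v))))) (*-identityˡ _))))
    -- As `L = 3 ℓ + 1`, more than `k * ℓ` on the left leaves at most `(3 − k) * ℓ` on the right.
    flip : ∀ v k k′ → k + k′ ≡ 3 → ¬ (r v ≤ k * ℓ) → L ∸ r v ≤ k′ * ℓ
    flip v k k′ sum r≰ = m≤n+o⇒m∸n≤o L (r v) (begin
      suc (3 * ℓ)              ≡⟨ cong (λ x → suc (x * ℓ)) (sym sum) ⟩
      suc ((k + k′) * ℓ)       ≡⟨ cong suc (*-distribʳ-+ ℓ k k′) ⟩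
      suc (k * ℓ) + k′ * ℓ     ≤⟨ +-monoˡ-≤ (k′ * ℓ) (≰⇒> r≰) ⟩
      r v + k′ * ℓ             ∎)
      where open ≤-Reasoning
    near : ∀ v → 2 ^ n′ ≤ f v (t v * L + 0) + f v (t v * L + L)
    near v with r v ≤? 1 * ℓ | r v ≤? 2 * ℓ
    ... | yes r≤ℓ | _         = ≤-trans (left v 1 (s≤s z≤n) r≤ℓ) (m≤m+n _ _)
    ... | no _    | no r≰2ℓ   = ≤-trans (right v 1 (s≤s z≤n) (flip v 2 1 refl r≰2ℓ)) (m≤n+m _ (f v (t v * L + 0)))
    ... | no r≰ℓ  | yes r≤2ℓ  = ≤-trans (≤-reflexive (sym 2^n′))
      (+-mono-≤ (left v 2 2≤n r≤2ℓ) (right v 2 2≤n (flip v 1 2 refl r≰ℓ)))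

  -- Structure of a minimum dominating set.

  module Minimum (D : Subset n) (D-min : IsMinPED n ℓ D) where

    χ : ℕ → ℕ
    χ = indicator D

    χ-periodic : Periodic n χ
    χ-periodic = indicator-periodic D

    open Discharging n′ ℓ′ χ χ-periodic using (total; n≤[1+3ℓ]*total; isolated)

    -- Minimality against `prog₀`. This is what makes the discharging tight in `gap`.
    total≤m : total ≤ m
    total≤m = ≤-trans (≤-reflexive (sym (card-indicator D))) (≤-trans (proj₂ D-min prog₀ prog₀-PED) ∣prog₀∣≤m)

    m≤total : m ≤ total
    m≤total = *-cancelˡ-≤ L (≤-trans (≤-reflexive (sym n≡)) (n≤[1+3ℓ]*total (dominated D (proj₁ D-min))))

    gap : ∀ v r → r < 3 * ℓ → 1 ≤ χ v → χ (v + suc r) ≡ 0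
    gap v r r<3ℓ 1≤χ = ∑≡0⇒term≡0 (3 * ℓ) (λ i → χ (v + suc i)) (isolated (dominated D (proj₁ D-min))
      (≤-trans (*-monoʳ-≤ L total≤m) (≤-reflexive (sym n≡))) 2≤n v 1≤χ) r<3ℓ

    window : ℕ → ℕ
    window v = ∑ L (λ j → χ (v + j))

    -- `gap` clears the `3 ℓ` vertices after a dominator, exactly the most that can follow it in a
    -- window of length `L`.
    window≤1 : ∀ v → window v ≤ 1
    window≤1 v = ∑-at-most-one L (λ i → bit≤1 _) λ i j i<j j<L 1≤χ →
      subst (λ x → χ x ≡ 0) (split i j i<j) (gap (v + i) (j ∸ suc i) (bound i j i<j j<L) 1≤χ)
      where
      split : ∀ i j → i < j → v + i + suc (j ∸ suc i) ≡ v + j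
      split i j i<j = trans (+-assoc v i _) (cong (v +_) (trans (+-suc i _) (m+[n∸m]≡n i<j)))
      bound : ∀ i j → i < j → j < L → j ∸ suc i < 3 * ℓ
      bound i (suc j) _ (s≤s j<) = ≤-trans (s≤s (m∸n≤m j i)) j<

    -- The `m` windows starting at `v + i * L` tile the cycle. Each holds at most one dominator and
    -- together they hold at least `m`, so none is empty.
    window≡1 : ∀ v → window v ≡ 1
    window≡1 v = trans (cong window (sym (+-identityʳ v)))
      (∑-saturated m {λ i → window (v + i * L)} (λ i → window≤1 (v + i * L)) (≤-trans m≤total (≤-reflexive total≡)) 0 (≤-trans (s≤s z≤n) 2≤m))
      where
      total≡ : total ≡ ∑ m (λ i → window (v + i * L))
      total≡ = trans (sym (∑-rotate n χ-periodic v)) (trans (cong (λ k → ∑ k (λ i → χ (v + i))) n≡mL)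
        (trans (∑-blocks m L (λ i → χ (v + i))) (∑-cong m (λ i _ → ∑-cong L (λ j _ → cong χ (sym (+-assoc v (i * L) j)))))))

    ∣D∩interval∣ : ∀ s → ∣ D ∩ interval n s (3 * ℓ) ∣ ≡ 1
    ∣D∩interval∣ s = begin
      ∣ D ∩ I ∣                                      ≡⟨ card-indicator (D ∩ I) ⟩
      ∑ n (indicator (D ∩ I))                        ≡⟨ sym (∑-rotate n (indicator-periodic (D ∩ I)) s) ⟩
      ∑ n (λ i → indicator (D ∩ I) (s + i))          ≡⟨ cong (λ k → ∑ k (λ i → indicator (D ∩ I) (s + i))) (sym (m+[n∸m]≡n (<⇒≤ L<n))) ⟩
      ∑ (L + (n ∸ L)) (λ i → indicator (D ∩ I) (s + i))
                                                     ≡⟨ ∑-split L (n ∸ L) (λ i → indicator (D ∩ I) (s + i)) ⟩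
      ∑ L (λ i → indicator (D ∩ I) (s + i)) + ∑ (n ∸ L) (λ i → indicator (D ∩ I) (s + (L + i)))
                                                     ≡⟨ cong₂ _+_ (∑-cong L inside) (∑-zero (n ∸ L) outside) ⟩
      window s + 0                                   ≡⟨ +-identityʳ (window s) ⟩
      window s                                       ≡⟨ window≡1 s ⟩
      1                                              ∎
      where
      open ≡-Reasoning
      I : Subset n
      I = interval n s (3 * ℓ)
      ∩-indicator : ∀ x → indicator (D ∩ I) x ≡ χ x * indicator I x
      ∩-indicator x = trans (cong bit (lookup-zipWith _∧_ (x mod n) D I)) (bit-∧ (lookup D (x mod n)) (lookup I (x mod n)))
      inside : ∀ i → i < L → indicator (D ∩ I) (s + i) ≡ χ (s + i)
      inside i i<L = trans (∩-indicator (s + i)) (trans (cong (χ (s + i) *_)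
        (T⇒bit (T-image⁺ (λ j → (s + j) % n) L ((s + i) mod n) (i , i<L , toℕ-mod-% (s + i))))) (*-identityʳ _))
      outside : ∀ i → i < n ∸ L → indicator (D ∩ I) (s + (L + i)) ≡ 0
      outside i i<n∸L = trans (∩-indicator (s + (L + i))) (trans (cong (χ (s + (L + i)) *_)
        (¬T⇒bit λ h → absurd (T-image⁻ (λ j → (s + j) % n) L ((s + (L + i)) mod n) h))) (*-zeroʳ (χ (s + (L + i)))))
        where
        -- The offsets `j < L` and `L + i < n` differ by a positive number below `n`, which `n`
        -- cannot divide.
        absurd : (∃ λ j → j < L × toℕ ((s + (L + i)) mod n) ≡ (s + j) % n) → ⊥
        absurd (j , j<L , eq) = <⇒≱ (≤-trans (s≤s (m∸n≤m (L + i) j)) (≤-trans (+-monoʳ-< L i<n∸L) (≤-reflexive (m+[n∸m]≡n (<⇒≤ L<n)))))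
          (∣⇒≤ {{>-nonZero (m<n⇒0<n∸m j<L+i)}} (%-≡⇒∣ (s + j) (L + i ∸ j) n
            (trans (sym eq) (trans (toℕ-mod-% (s + (L + i))) (cong (_% n)
              (trans (cong (s +_) (sym (m+[n∸m]≡n (<⇒≤ j<L+i)))) (sym (+-assoc s j (L + i ∸ j)))))))))
          where
          j<L+i : j < L + i
          j<L+i = ≤-trans j<L (m≤m+n L i)

    -- The window that starts just after `x` holds one dominator, and `gap` rules out all its places
    -- except the last.
    next : ∀ x → 1 ≤ χ x → 1 ≤ χ (x + L)
    next x 1≤χ = ≤-reflexive (begin
      1                                                          ≡⟨ sym (window≡1 (suc x)) ⟩
      window (suc x)                                             ≡⟨ ∑-snoc (3 * ℓ) (λ j → χ (suc x + j)) ⟩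
      ∑ (3 * ℓ) (λ j → χ (suc x + j)) + χ (suc x + 3 * ℓ)        ≡⟨ cong₂ _+_ (∑-zero (3 * ℓ) empty) (cong χ (sym (+-suc x (3 * ℓ)))) ⟩
      χ (x + L)                                                  ∎)
      where
      open ≡-Reasoning
      empty : ∀ j → j < 3 * ℓ → χ (suc x + j) ≡ 0
      empty j j<3ℓ = trans (cong χ (sym (+-suc x j))) (gap x j j<3ℓ 1≤χ)

    -- Iterating `next` from a dominator `j` of the first window puts the whole progression into
    -- `D`. Conversely, a vertex off the progression lies in a gap behind one of its members.
    D≡progression : ∃ λ c → D ≡ progression n c L m
    D≡progression with ∑-positive L (≤-reflexive (sym (window≡1 0)))
    ... | j , j<L , 1≤χj = j mod n , trans (sym (tabulate∘lookup D)) (tabulate-cong λ v →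
        trans (T-ext (λ h → T-image⁺ step m v (D⇒ v h)) (λ h → ⇒D v (T-image⁻ step m v h)))
              (lookup∘tabulate (λ v → any (λ t → toℕ v ≡ᵇ step t) (upTo m)) v))
      where
      step : ℕ → ℕ
      step t = (toℕ (j mod n) + L * t) % n
      step≡ : ∀ t → step t ≡ (j + L * t) % n
      step≡ t = toℕ-mod-+ j (L * t)
      all : ∀ t → 1 ≤ χ (j + L * t)
      all zero    = subst (λ x → 1 ≤ χ x) (sym (trans (cong (j +_) (*-zeroʳ L)) (+-identityʳ j))) 1≤χj
      all (suc t) = subst (λ x → 1 ≤ χ x) (ring j L t) (next (j + L * t) (all t))
        where
        ring : ∀ j L t → j + L * t + L ≡ j + L * suc t
        ring = solve-∀
      ⇒D : ∀ v → (∃ λ t → t < m × toℕ v ≡ step t) → T (lookup D v)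
      ⇒D v (t , _ , eq) = subst (T ∘ lookup D) (toℕ-injective (trans (toℕ-mod-% (j + L * t)) (sym (trans eq (step≡ t)))))
        (bit⇒T (all t))
      D⇒ : ∀ v → T (lookup D v) → ∃ λ t → t < m × toℕ v ≡ step t
      D⇒ v h = locate w%L (w / L) decomposition (m%n<n w L)
        where
        open ≡-Reasoning
        w w%L : ℕ
        -- The difference `v − j`, raised by `n` to stay in `ℕ`; its residue modulo `L` decides
        -- membership in the progression.
        w = toℕ v + (n ∸ j)
        w%L = w % L
        regroup : ∀ j x k r → j + (r + x * k) ≡ j + k * x + r
        regroup = solve-∀
        decomposition : toℕ v + n ≡ j + L * (w / L) + w%L
        decomposition = begin
          toℕ v + n                        ≡⟨ cong (toℕ v +_) (sym (m+[n∸m]≡n (<⇒≤ (<-trans j<L L<n)))) ⟩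
          toℕ v + (j + (n ∸ j))            ≡⟨ sym (+-assoc (toℕ v) j (n ∸ j)) ⟩
          toℕ v + j + (n ∸ j)              ≡⟨ cong (_+ (n ∸ j)) (+-comm (toℕ v) j) ⟩
          j + toℕ v + (n ∸ j)              ≡⟨ +-assoc j (toℕ v) (n ∸ j) ⟩
          j + w                            ≡⟨ cong (j +_) (m≡m%n+[m/n]*n w L) ⟩
          j + (w%L + w / L * L)            ≡⟨ regroup j (w / L) L w%L ⟩
          j + L * (w / L) + w%L            ∎
        locate : ∀ r q → toℕ v + n ≡ j + L * q + r → r < L → ∃ λ t → t < m × toℕ v ≡ step t
        locate zero q eq _ with reduce j q
        ... | t , t<m , eq′ = t , t<m , (begin
          toℕ v                    ≡⟨ sym (m<n⇒m%n≡m (toℕ<n v)) ⟩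
          toℕ v % n                ≡⟨ sym ([m+n]%n≡m%n (toℕ v) n) ⟩
          (toℕ v + n) % n          ≡⟨ cong (λ x → x % n) (trans eq (+-identityʳ (j + L * q))) ⟩
          (j + L * q) % n          ≡⟨ eq′ ⟩
          (j + L * t) % n          ≡⟨ sym (step≡ t) ⟩
          step t                   ∎)
        locate (suc r) q eq (s≤s r<3ℓ) = contradiction (begin
          1                        ≡⟨ sym (T⇒bit h) ⟩
          bit (lookup D v)         ≡⟨ cong (bit ∘ lookup D) (sym (toℕ-mod v)) ⟩
          χ (toℕ v)                ≡⟨ sym (χ-periodic (toℕ v)) ⟩
          χ (toℕ v + n)            ≡⟨ cong χ eq ⟩
          χ (j + L * q + suc r)    ≡⟨ gap (j + L * q) r r<3ℓ (all q) ⟩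
          0                        ∎) 1+n≢0

-- With `n` and `L` as variables, matching can turn `n` and `ℓ` into successors and `L` into
-- `suc (3 * ℓ)`, while callers may write the step as `3 * ℓ + 1`.
minimum-PED-structure : ∀ n ℓ m L .{{_ : NonZero n}} → L ≡ suc (3 * ℓ) → n ≡ L * m → 1 ≤ ℓ → 2 ≤ m → (D : Subset n) →
  IsMinPED n ℓ D → (∀ s → ∣ D ∩ interval n s (3 * ℓ) ∣ ≡ 1) × ∃ λ c → D ≡ progression n c L m
minimum-PED-structure (suc n′) (suc ℓ′) m .(suc (3 * suc ℓ′)) refl n≡ _ 2≤m D D-min = ∣D∩interval∣ , D≡progression
  where open Spacing.Minimum n′ ℓ′ m n≡ 2≤m D D-min

theorem2 : (ℓ m : ℕ) → (hℓ : 1 ≤ ℓ) → (hm : 2 ≤ m) → (D : Subset ((3 * ℓ + 1) * m))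
    → IsMinPED ((3 * ℓ + 1) * m) ℓ {{nz ℓ m (≤-trans (s≤s z≤n) hm)}} D
    → ((s i : ℕ) → i < m
    → ∣ D ∩ interval ((3 * ℓ + 1) * m) {{nz ℓ m (≤-trans (s≤s z≤n) hm)}} (s + (3 * ℓ + 1) * i) (3 * ℓ) ∣ ≡ 1)
    × ∃ (λ (c : Fin ((3 * ℓ + 1) * m))
    → D ≡ progression ((3 * ℓ + 1) * m) {{nz ℓ m (≤-trans (s≤s z≤n) hm)}} c (3 * ℓ + 1) m)
theorem2 ℓ m hℓ hm D D-min
  with minimum-PED-structure ((3 * ℓ + 1) * m) ℓ m (3 * ℓ + 1) {{nz ℓ m (≤-trans (s≤s z≤n) hm)}} (+-comm (3 * ℓ) 1) refl hℓ hm D D-min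
... | windows , unique = (λ s i _ → windows (s + (3 * ℓ + 1) * i)) , unique
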